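{- Let $k\ge1$ and let $G$ be a $k$-connected partial $k$-path. Then $Z(G)=M(G)=k$.
   Context: All graphs are simple and undirected. A $k$-path is a graph $H$ built together with a sequence $e_0,t_1,e_1,\dots,t_p,e_p$ ($p\ge1$): $t_1$ is a complete graph $K_{k+1}$ and $e_0,e_1$ are distinct $k$-subsets of $t_1$; for $i=2,\dots,p$ a new vertex $u_i$ is added adjacent exactly to the vertices of $e_{i-1}$, $t_i=e_{i-1}\cup\{u_i\}$, and $e_i$ is a $k$-subset of $t_i$ different from $e_{i-1}$. A partial $k$-path is any subgraph of a $k$-path. A graph is $k$-connected if its vertex connectivity is at least $k$ (vertex connectivity of a connected non-complete graph is the minimum number of vertices whose removal disconnects it; that of $K_n$ is $n-1$). For a graph $G$ on $n$ vertices, $S(G)$ is the set of real symmetric $n\times n$ matrices whose off-diagonal entry $(i,j)$ is nonzero iff $ij\in E(G)$ (diagonal unrestricted); $M(G)=\max\{\operatorname{nullity}A:A\in S(G)\}$. $Z(G)$ is the zero forcing number: the minimum size of an initial set of blue vertices from which all vertices become blue under the rule "a blue vertex with exactly one white neighbor turns that neighbor blue". -}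

module Defs where

open import Level using (0ℓ) renaming (suc to lsuc)
open import Data.Nat using (ℕ; zero; suc; _∸_) renaming (_≤_ to _≤ℕ_)
open import Data.Fin using (Fin; zero; suc; _≟_)
open import Data.Fin.Subset using (Subset; _∈_; _∉_; _⊆_; ∣_∣; ⊥; ⊤; ⁅_⁆; _∪_)
open import Data.Bool using (Bool; true; false; T; not)
open import Data.Vec using (Vec; _∷_; lookup)
import Data.Sum
open import Data.Product using (Σ; _×_; _,_; ∃; ∃-syntax)
open import Relation.Nullary using (¬_; does)
open import Relation.Binary.PropositionalEquality using (_≡_; _≢_)
open import Function using (_⇔_)
open import Function.Definitions using (Injective)
open import Algebra.Bundles using (CommutativeRing)

record Graph (n : ℕ) : Set where
  field
    adj    : Fin n → Fin n → Bool
    sym    : ∀ i j → adj i j ≡ adj j i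
    irrefl : ∀ i → adj i i ≡ false

open Graph public

Edge : ∀ {n} → Graph n → Fin n → Fin n → Set
Edge G i j = T (adj G i j)

-- k-paths.  'KPath k A e' : the raw adjacency A on Fin m is (a labelled
-- copy of) a k-path, built by the sequence e_0,t_1,e_1,...,t_p,e_p of the
-- definition, whose last k-set is e (= e_p).  New vertices u_i are added
-- at index zero (old vertices are shifted by suc).

data KPath (k : ℕ) : {m : ℕ} → (Fin m → Fin m → Bool) → Subset m → Set where
  start : ∀ {A : Fin (suc k) → Fin (suc k) → Bool} (e₀ e₁ : Subset (suc k)) →
          (∀ i j → A i j ≡ not (does (i ≟ j))) →
          ∣ e₀ ∣ ≡ k → ∣ e₁ ∣ ≡ k → e₀ ≢ e₁ →
          KPath k A e₁
  -- add u_i (index zero) adjacent exactly to e_{i-1}; t_i = e_{i-1} ∪ {u_i};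
  -- e_i a k-subset of t_i different from e_{i-1}
  extend : ∀ {m} {A : Fin m → Fin m → Bool} {e : Subset m}
             {A' : Fin (suc m) → Fin (suc m) → Bool} (e' : Subset (suc m)) →
           KPath k A e →
           A' zero zero ≡ false →
           (∀ j → A' zero (suc j) ≡ lookup e j) →
           (∀ j → A' (suc j) zero ≡ lookup e j) →
           (∀ i j → A' (suc i) (suc j) ≡ A i j) →
           e' ⊆ (true ∷ e) → ∣ e' ∣ ≡ k → e' ≢ (false ∷ e) →
           KPath k A' e'

-- partial k-path: (isomorphic to) a subgraph of some k-path, i.e. there is
-- an injective edge-preserving map into a k-path
PartialKPath : ℕ → ∀ {n} → Graph n → Set
PartialKPath k {n} G =
  ∃[ m ] Σ (Fin m → Fin m → Bool) λ H → Σ (Subset m) λ e → KPath k H e ×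
    Σ (Fin n → Fin m) λ f → Injective _≡_ _≡_ f ×
      (∀ i j → Edge G i j → T (H (f i) (f j)))

data Reach {n} (G : Graph n) (S : Subset n) : Fin n → Fin n → Set where
  here : ∀ {i} → i ∉ S → Reach G S i i
  step : ∀ {i j l} → Reach G S i j → l ∉ S → Edge G j l → Reach G S i l

ConnectedWithout : ∀ {n} → Graph n → Subset n → Set
ConnectedWithout G S = ∀ i j → i ∉ S → j ∉ S → Reach G S i j

Connected : ∀ {n} → Graph n → Set
Connected G = ConnectedWithout G ⊥

IsComplete : ∀ {n} → Graph n → Set
IsComplete G = ∀ i j → i ≢ j → Edge G i j

-- S disconnects G: G - S is not connected (empty G - S counts as connected)
Disconnects : ∀ {n} → Graph n → Subset n → Set
Disconnects G S = ¬ ConnectedWithout G S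

-- vertex connectivity ≥ k, following the definition: K_n has connectivity
-- n-1; a connected non-complete graph has connectivity = minimum size of a
-- disconnecting set; a disconnected graph has connectivity 0.
KConnected : ℕ → ∀ {n} → Graph n → Set
KConnected k {n} G =
  (IsComplete G → k ≤ℕ n ∸ 1) ×
  (¬ IsComplete G → Connected G × (∀ S → Disconnects G S → k ≤ℕ ∣ S ∣))

data Force {n} (G : Graph n) (B : Subset n) : Subset n → Set where
  force : ∀ v w → v ∈ B → w ∉ B → Edge G v w →
          (∀ x → Edge G v x → x ∉ B → x ≡ w) →
          Force G B (B ∪ ⁅ w ⁆)

data Forces {n} (G : Graph n) : Subset n → Subset n → Set where
  done : ∀ {B} → Forces G B B
  more : ∀ {B B' B''} → Force G B B' → Forces G B' B'' → Forces G B B''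

ZeroForcingSet : ∀ {n} → Graph n → Subset n → Set
ZeroForcingSet G B = Forces G B ⊤

ZeroForcingNumber : ∀ {n} → Graph n → ℕ → Set
ZeroForcingNumber G z =
  (∃[ B ] ZeroForcingSet G B × ∣ B ∣ ≡ z) ×
  (∀ B → ZeroForcingSet G B → z ≤ℕ ∣ B ∣)

-- The real numbers: a complete ordered field (unique up to isomorphism).

record CompleteOrderedField : Set₁ where
  field
    commRing : CommutativeRing 0ℓ 0ℓ
  open CommutativeRing commRing public using (Carrier; _≈_; _+_; _*_; 0#; 1#)
  field
    nontrivial : ¬ (1# ≈ 0#)
    inverse    : ∀ x → ¬ (x ≈ 0#) → ∃[ y ] (x * y ≈ 1#)
    _≤_        : Carrier → Carrier → Set
    ≤-resp     : ∀ {x x' y y'} → x ≈ x' → y ≈ y' → x ≤ y → x' ≤ y'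
    ≤-refl     : ∀ {x} → x ≤ x
    ≤-trans    : ∀ {x y z} → x ≤ y → y ≤ z → x ≤ z
    ≤-antisym  : ∀ {x y} → x ≤ y → y ≤ x → x ≈ y
    ≤-total    : ∀ x y → Data.Sum._⊎_ (x ≤ y) (y ≤ x)
    +-mono     : ∀ {x y} z → x ≤ y → (x + z) ≤ (y + z)
    *-nonneg   : ∀ {x y} → 0# ≤ x → 0# ≤ y → 0# ≤ (x * y)
    lub        : (P : Carrier → Set) → ∃[ x ] P x →
                 ∃[ b ] (∀ x → P x → x ≤ b) →
                 ∃[ s ] ((∀ x → P x → x ≤ s) ×
                         (∀ b → (∀ x → P x → x ≤ b) → s ≤ b))

module Matrices (ℝ : CompleteOrderedField) where
  open CompleteOrderedField ℝ

  Σ[_] : ∀ n → (Fin n → Carrier) → Carrier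
  Σ[ zero ] f = 0#
  Σ[ suc n ] f = f zero + Σ[ n ] (λ i → f (suc i))

  Matrix : ℕ → Set
  Matrix n = Fin n → Fin n → Carrier

  InS : ∀ {n} → Graph n → Matrix n → Set
  InS G A = (∀ i j → A i j ≈ A j i) ×
            (∀ i j → i ≢ j → (Edge G i j ⇔ (¬ (A i j ≈ 0#))))

  IndepKernel : ∀ {n} → Matrix n → (r : ℕ) → (Fin r → Fin n → Carrier) → Set
  IndepKernel {n} A r v =
    (∀ l i → Σ[ n ] (λ j → A i j * v l j) ≈ 0#) ×
    (∀ (c : Fin r → Carrier) →
       (∀ j → Σ[ r ] (λ l → c l * v l j) ≈ 0#) → ∀ l → c l ≈ 0#)

  NullityAtLeast : ∀ {n} → Matrix n → ℕ → Set
  NullityAtLeast {n} A r = ∃[ v ] IndepKernel A r v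

  MaxNullity : ∀ {n} → Graph n → ℕ → Set
  MaxNullity G r =
    (∃[ A ] InS G A × NullityAtLeast A r) ×
    (∀ A → InS G A → ¬ NullityAtLeast A (suc r))

-- Upper bounds: if B forces G, a kernel vector vanishing on B is zero, so the
-- nullity of every A ∈ S(G) is at most |B|; a forcing set of size k is found by
-- running along the k-path backwards, where u_i forces the vertex v_i dropped at
-- step i: if u_i v_i is not an edge of G, the other k-1 vertices of e_{i-1}
-- would be a separator, unless everything is already blue.
--
-- Lower bound (Lovász–Saks–Schrijver): k-connectivity yields vectors f v in
-- dimension d = n - k such that f a · f b = 0 exactly for nonadjacent a ≠ b, and
-- the Gram matrix of f has nullity at least k.  Vectors are chosen one by one,
-- each orthogonal to its earlier nonneighbours.  Two such choices for the same
-- order are joined by a polynomial curve, so open (polynomially nonvanishing)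
-- conditions that hold at one end each hold simultaneously somewhere on it.
-- Call f z-good on a vertex set M if any d vectors other than f z are independent.
-- For adjacent j and l, which do not constrain each other, the order ending in
-- j, l carries a j-good and an l-good choice, hence one that is both; since every
-- M with |M| > d is connected, some f is z-good for all z ∈ M, so any d of its
-- vectors are independent.

module Submission where

open import Defs renaming (sym to adj-sym)
open import Data.Nat using (ℕ; zero; suc)
import Data.Nat as ℕ
import Data.Nat.Properties as ℕ
open import Data.Bool using (Bool; T; true; false; if_then_else_)
open import Data.Bool.Properties using (T?; T-≡)
open import Data.Fin using (Fin; zero; suc; _≟_; punchIn; punchOut; toℕ)
import Data.Fin as Fin
import Data.Fin.Properties as Fin
import Data.Fin.Subset as Subset
open Subset using (Subset; ∣_∣; _-_; _∪_; ⁅_⁆)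
import Data.Fin.Subset.Properties as Subset
open import Data.Product using (_×_; _,_; proj₁; proj₂; ∃; ∃-syntax)
open import Data.Sum using (_⊎_; inj₁; inj₂)
open import Data.Maybe using (Maybe; just; nothing)
open import Data.Maybe.Properties using (just-injective; ≡-dec)
import Data.Maybe.Relation.Unary.All as Maybe
open import Data.Vec using ([]; _∷_)
import Data.Vec as Vec
import Data.Vec.Properties as Vec
import Data.Vec.Functional as Vector
import Data.Vec.Functional.Properties as Vector
open import Data.List using (List; []; _∷_; map; filter; length; allFin; tabulate; cartesianProduct; lookup)
open import Data.List.Properties using (map-cong-local; filter-notAll; length-map; length-tabulate)
open import Data.List.Relation.Unary.All as All using (All; []; _∷_)
import Data.List.Relation.Unary.All.Properties as All
open import Data.List.Relation.Unary.Any as Any using (here; there)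
import Data.List.Relation.Unary.Any.Properties as Any
open import Data.List.Relation.Unary.AllPairs using ([]; _∷_)
open import Data.List.Relation.Unary.Unique.Propositional using (Unique)
import Data.List.Relation.Unary.Unique.Propositional.Properties as Unique
import Data.List.Relation.Unary.Unique.DecPropositional as DecUnique
open import Data.List.Membership.Propositional using (_∈_; _∉_; find)
open import Data.List.Membership.Propositional.Properties
  using (∈-filter⁺; ∈-filter⁻; ∈-allFin; ∈-cartesianProduct⁺; ∈-map⁺; ∈-tabulate⁺)
import Data.List.Membership.DecPropositional as DecMembership
open import Data.Unit using (⊤; tt)
open import Function using (_∘_; id; Equivalence; mk⇔)
open import Relation.Nullary using (¬_; Dec; yes; no; does; contradiction)
open import Relation.Nullary.Decidable using (¬?; _×-dec_; dec-true; dec-false; decidable-stable)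
open import Relation.Unary using (Decidable)
open import Relation.Binary.PropositionalEquality as ≡ using (_≡_; _≢_)
open import Algebra.Bundles using (CommutativeRing)
import Algebra.Properties.Ring
import Algebra.Solver.Ring.NaturalCoefficients.Default
import Relation.Binary.Reasoning.Setoid

-- Complete ordered fields

module OrderedField (ℝ : CompleteOrderedField) where
  open CompleteOrderedField ℝ public
  open CommutativeRing commRing public
    hiding (Carrier; _≈_; _+_; _*_; 0#; 1#; zero)
  open Algebra.Properties.Ring ring public
    using (-‿distribˡ-*; -‿distribʳ-*; -‿involutive; -0#≈0#)
  module Solver = Algebra.Solver.Ring.NaturalCoefficients.Default commutativeSemiring
  open Relation.Binary.Reasoning.Setoid setoid public

  0≤1 : 0# ≤ 1#
  0≤1 with ≤-total 0# 1#
  ... | inj₁ p = p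
  ... | inj₂ p = ≤-resp refl square (*-nonneg 0≤-1 0≤-1)
    where
    0≤-1 : 0# ≤ (- 1#)
    0≤-1 = ≤-resp (-‿inverseʳ 1#) (+-identityˡ _) (+-mono (- 1#) p)
    square : - 1# * - 1# ≈ 1#
    square = begin
      - 1# * - 1#      ≈⟨ -‿distribˡ-* 1# (- 1#) ⟨
      - (1# * - 1#)    ≈⟨ -‿cong (*-identityˡ _) ⟩
      - (- 1#)         ≈⟨ -‿involutive 1# ⟩
      1#               ∎

  1≰0 : ¬ (1# ≤ 0#)
  1≰0 p = nontrivial (≤-antisym p 0≤1)

  -- The set {z | ¬¬ z ≈ 0} is closed under addition of x and bounded by 1;
  -- its supremum s satisfies s ≤ s - x.
  ¬¬0⇒≤0 : ∀ {x} → ¬ (x ≉ 0#) → x ≤ 0#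
  ¬¬0⇒≤0 {x} ¬x≉0 with lub (λ z → ¬ (z ≉ 0#)) (0# , λ p → p refl) (1# , bounded)
    where
    bounded : ∀ z → ¬ (z ≉ 0#) → z ≤ 1#
    bounded z ¬z≉0 with ≤-total z 1#
    ... | inj₁ p = p
    ... | inj₂ p = contradiction (λ z≈0 → 1≰0 (≤-resp refl z≈0 p)) ¬z≉0
  ... | s , upper , least = ≤-resp left right (+-mono (x + - s) s≤s-x)
    where
    shift : ∀ z → ¬ (z ≉ 0#) → z ≤ (s + - x)
    shift z ¬z≉0 = ≤-resp cancel refl (+-mono (- x) (upper (z + x) z+x≈0))
      where
      z+x≈0 : ¬ (z + x ≉ 0#)
      z+x≈0 k = ¬z≉0 λ z≈0 → ¬x≉0 λ x≈0 → k (trans (+-cong z≈0 x≈0) (+-identityˡ 0#))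
      cancel : (z + x) + - x ≈ z
      cancel = trans (+-assoc z x _) (trans (+-congˡ (-‿inverseʳ x)) (+-identityʳ z))
    s≤s-x : s ≤ (s + - x)
    s≤s-x = least _ shift
    left : s + (x + - s) ≈ x
    left = begin
      s + (x + - s)  ≈⟨ +-congˡ (+-comm x _) ⟩
      s + (- s + x)  ≈⟨ +-assoc s _ x ⟨
      (s + - s) + x  ≈⟨ +-congʳ (-‿inverseʳ s) ⟩
      0# + x         ≈⟨ +-identityˡ x ⟩
      x              ∎
    right : (s + - x) + (x + - s) ≈ 0#
    right = begin
      (s + - x) + (x + - s)  ≈⟨ +-assoc s _ _ ⟩
      s + (- x + (x + - s))  ≈⟨ +-congˡ (+-assoc (- x) x _) ⟨
      s + ((- x + x) + - s)  ≈⟨ +-congˡ (+-congʳ (-‿inverseˡ x)) ⟩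
      s + (0# + - s)         ≈⟨ +-congˡ (+-identityˡ _) ⟩
      s + - s                ≈⟨ -‿inverseʳ s ⟩
      0#                     ∎

  ¬¬0⇒0 : ∀ {x} → ¬ (x ≉ 0#) → x ≈ 0#
  ¬¬0⇒0 {x} ¬x≉0 = ≤-antisym (¬¬0⇒≤0 ¬x≉0) 0≤x
    where
    -x≤0 : (- x) ≤ 0#
    -x≤0 = ¬¬0⇒≤0 λ k → ¬x≉0 λ x≈0 → k (trans (-‿cong x≈0) -0#≈0#)
    0≤x : 0# ≤ x
    0≤x = ≤-resp (-‿inverseˡ x) (+-identityˡ x) (+-mono x -x≤0)

  -- Whether sup ({0} ∪ {2 | Q}) is below or above 1 decides ¬ Q.
  weak-excluded-middle : (Q : Set) → ¬ Q ⊎ ¬ ¬ Q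
  weak-excluded-middle Q with lub P (0# , inj₁ refl) (2# , bounded)
    where
    2# = 1# + 1#
    P : Carrier → Set
    P z = z ≈ 0# ⊎ (z ≈ 2# × Q)
    0≤2 : 0# ≤ 2#
    0≤2 = ≤-trans 0≤1 (≤-resp (+-identityˡ 1#) refl (+-mono 1# 0≤1))
    bounded : ∀ z → P z → z ≤ 2#
    bounded z (inj₁ z≈0)       = ≤-resp (sym z≈0) refl 0≤2
    bounded z (inj₂ (z≈2 , _)) = ≤-resp (sym z≈2) refl ≤-refl
  ... | s , upper , least with ≤-total s 1#
  ...   | inj₁ s≤1 = inj₁ λ q → 1≰0 (≤-resp (cancel 1#) (-‿inverseʳ 1#)
                       (+-mono (- 1#) (≤-trans (upper _ (inj₂ (refl , q))) s≤1)))
    where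
    cancel : ∀ z → (1# + z) + - z ≈ 1#
    cancel z = trans (+-assoc _ z _) (trans (+-congˡ (-‿inverseʳ z)) (+-identityʳ _))
  ...   | inj₂ 1≤s = inj₂ λ ¬q → 1≰0 (≤-trans 1≤s (least 0# λ where
                       z (inj₁ z≈0)     → ≤-resp (sym z≈0) refl ≤-refl
                       z (inj₂ (_ , q)) → contradiction q ¬q))

  -- No excluded middle is assumed: completeness of the field refutes or doubly negates the
  -- equation, and `¬¬0⇒0` removes the double negation.
  ≈0? : ∀ x → Dec (x ≈ 0#)
  ≈0? x with weak-excluded-middle (x ≈ 0#)
  ... | inj₁ x≉0  = no x≉0
  ... | inj₂ ¬x≉0 = yes (¬¬0⇒0 ¬x≉0)

  *-cancel-0 : ∀ {x y} → x ≉ 0# → x * y ≈ 0# → y ≈ 0#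
  *-cancel-0 {x} {y} x≉0 xy≈0 with inverse x x≉0
  ... | x⁻¹ , xx⁻¹≈1 = begin
    y               ≈⟨ *-identityˡ y ⟨
    1# * y          ≈⟨ *-congʳ xx⁻¹≈1 ⟨
    (x * x⁻¹) * y   ≈⟨ *-congʳ (*-comm x x⁻¹) ⟩
    (x⁻¹ * x) * y   ≈⟨ *-assoc x⁻¹ x y ⟩
    x⁻¹ * (x * y)   ≈⟨ *-congˡ xy≈0 ⟩
    x⁻¹ * 0#        ≈⟨ zeroʳ x⁻¹ ⟩
    0#              ∎

  *-nonzero : ∀ {x y} → x ≉ 0# → y ≉ 0# → x * y ≉ 0#
  *-nonzero x≉0 y≉0 xy≈0 = y≉0 (*-cancel-0 x≉0 xy≈0)

  ≉-resp : ∀ {x y} → x ≈ y → x ≉ 0# → y ≉ 0#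
  ≉-resp x≈y x≉0 y≈0 = x≉0 (trans x≈y y≈0)

  *-nonzeroˡ : ∀ {x y} → x * y ≉ 0# → x ≉ 0#
  *-nonzeroˡ {x} {y} xy≉0 x≈0 = xy≉0 (trans (*-congʳ x≈0) (zeroˡ y))

  *-nonzeroʳ : ∀ {x y} → x * y ≉ 0# → y ≉ 0#
  *-nonzeroʳ {x} {y} xy≉0 y≈0 = xy≉0 (trans (*-congˡ y≈0) (zeroʳ x))

-- Finite sums and properties of all large reals.

module Sums (ℝ : CompleteOrderedField) where
  open OrderedField ℝ public
  open Matrices ℝ public
  open Solver using (solve; _:=_; _:+_; _:*_)

  Σ-cong : ∀ n {f g : Fin n → Carrier} → (∀ i → f i ≈ g i) → Σ[ n ] f ≈ Σ[ n ] g
  Σ-cong zero    f≈g = refl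
  Σ-cong (suc n) f≈g = +-cong (f≈g zero) (Σ-cong n (f≈g ∘ suc))

  Σ-zero : ∀ n {f : Fin n → Carrier} → (∀ i → f i ≈ 0#) → Σ[ n ] f ≈ 0#
  Σ-zero zero    f≈0 = refl
  Σ-zero (suc n) f≈0 = trans (+-cong (f≈0 zero) (Σ-zero n (f≈0 ∘ suc))) (+-identityˡ 0#)

  Σ-+ : ∀ n (f g : Fin n → Carrier) → Σ[ n ] (λ i → f i + g i) ≈ Σ[ n ] f + Σ[ n ] g
  Σ-+ zero    f g = sym (+-identityˡ 0#)
  Σ-+ (suc n) f g = trans (+-congˡ (Σ-+ n (f ∘ suc) (g ∘ suc)))
    (solve 4 (λ a b c d → (a :+ b) :+ (c :+ d) := (a :+ c) :+ (b :+ d)) refl _ _ _ _)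

  Σ-* : ∀ n a (f : Fin n → Carrier) → Σ[ n ] (λ i → a * f i) ≈ a * Σ[ n ] f
  Σ-* zero    a f = sym (zeroʳ a)
  Σ-* (suc n) a f = trans (+-congˡ (Σ-* n a (f ∘ suc))) (sym (distribˡ a _ _))

  Σ-swap : ∀ m n (f : Fin m → Fin n → Carrier) →
           Σ[ m ] (λ i → Σ[ n ] (f i)) ≈ Σ[ n ] (λ j → Σ[ m ] (λ i → f i j))
  Σ-swap zero    n f = sym (Σ-zero n λ _ → refl)
  Σ-swap (suc m) n f = trans (+-congˡ (Σ-swap m n (f ∘ suc))) (sym (Σ-+ n _ _))

  Σ-single : ∀ n (f : Fin n → Carrier) i → (∀ j → j ≢ i → f j ≈ 0#) → Σ[ n ] f ≈ f i
  Σ-single (suc n) f zero    f≈0 =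
    trans (+-congˡ (Σ-zero n λ j → f≈0 (suc j) λ ())) (+-identityʳ _)
  Σ-single (suc n) f (suc i) f≈0 =
    trans (+-cong (f≈0 zero λ ()) (Σ-single n (f ∘ suc) i λ j j≢i → f≈0 (suc j) (λ { ≡.refl → j≢i ≡.refl })))
          (+-identityˡ _)

  unit : ∀ {n} → Fin n → Fin n → Carrier
  unit i j = if does (i ≟ j) then 1# else 0#

  unit-≡ : ∀ {n} (i : Fin n) → unit i i ≈ 1#
  unit-≡ i rewrite dec-true (i ≟ i) ≡.refl = refl

  unit-≢ : ∀ {n} {i j : Fin n} → i ≢ j → unit i j ≈ 0#
  unit-≢ {i = i} {j} i≢j rewrite dec-false (i ≟ j) i≢j = refl

  Σ-unit : ∀ {n} i (x : Fin n → Carrier) → Σ[ n ] (λ j → unit i j * x j) ≈ x i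
  Σ-unit i x = trans (Σ-single _ _ i λ j j≢i → trans (*-congʳ (unit-≢ (j≢i ∘ ≡.sym))) (zeroˡ _))
                     (trans (*-congʳ (unit-≡ i)) (*-identityˡ _))

  -- Holding for all large `t` is stable under finite conjunction, so finitely many nonvanishing
  -- conditions are met at one common `t` without counting roots.
  Eventually : (Carrier → Set) → Set
  Eventually P = ∃[ t₀ ] (∀ t → t₀ ≤ t → P t)

  eventually-pure : ∀ {P} → (∀ t → P t) → Eventually P
  eventually-pure p = 0# , λ t _ → p t

  eventually-map : ∀ {P Q} → (∀ t → P t → Q t) → Eventually P → Eventually Q
  eventually-map f (t₀ , p) = t₀ , λ t t₀≤t → f t (p t t₀≤t)

  eventually-× : ∀ {P Q} → Eventually P → Eventually Q → Eventually (λ t → P t × Q t)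
  eventually-× (t₁ , p) (t₂ , q) with ≤-total t₁ t₂
  ... | inj₁ t₁≤t₂ = t₂ , λ t t₂≤t → p t (≤-trans t₁≤t₂ t₂≤t) , q t t₂≤t
  ... | inj₂ t₂≤t₁ = t₁ , λ t t₁≤t → p t t₁≤t , q t (≤-trans t₂≤t₁ t₁≤t)

  eventually-Fin : ∀ n {P : Fin n → Carrier → Set} → (∀ i → Eventually (P i)) →
                   Eventually (λ t → ∀ i → P i t)
  eventually-Fin zero    p = eventually-pure λ _ ()
  eventually-Fin (suc n) p =
    eventually-map (λ { t (q , qs) zero → q ; t (q , qs) (suc i) → qs i })
      (eventually-× (p zero) (eventually-Fin n (p ∘ suc)))

  eventually-List : ∀ {n} r {P : List (Fin n) → Carrier → Set} → (∀ T → Eventually (P T)) →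
                    Eventually (λ t → ∀ T → length T ℕ.≤ r → P T t)
  eventually-List zero    p = eventually-map (λ { t q [] _ → q }) (p [])
  eventually-List (suc r) p =
    eventually-map (λ { t (q , qs) [] _ → q ; t (q , qs) (x ∷ T) (ℕ.s≤s len) → qs x T len })
      (eventually-× (p []) (eventually-Fin _ λ x → eventually-List r (p ∘ (x ∷_))))

  eventually-∃ : ∀ {P} → Eventually P → ∃ P
  eventually-∃ (t₀ , p) = t₀ , p t₀ ≤-refl

  -- Polynomial functions

  eval : List Carrier → Carrier → Carrier
  eval []      t = 0#
  eval (c ∷ p) t = c + t * eval p t

  IsPoly : (Carrier → Carrier) → Set
  IsPoly h = ∃[ p ] (∀ t → h t ≈ eval p t)

  scale : Carrier → List Carrier → List Carrier
  scale a = map (a *_)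

  eval-scale : ∀ a p t → a * eval p t ≈ eval (scale a p) t
  eval-scale a []      t = zeroʳ a
  eval-scale a (c ∷ p) t = begin
    a * (c + t * eval p t)          ≈⟨ solve 4 (λ a c t e → a :* (c :+ t :* e) := a :* c :+ t :* (a :* e)) refl a c t _ ⟩
    a * c + t * (a * eval p t)      ≈⟨ +-congˡ (*-congˡ (eval-scale a p t)) ⟩
    a * c + t * eval (scale a p) t  ∎

  add : List Carrier → List Carrier → List Carrier
  add []      q       = q
  add (c ∷ p) []      = c ∷ p
  add (c ∷ p) (d ∷ q) = (c + d) ∷ add p q

  eval-add : ∀ p q t → eval p t + eval q t ≈ eval (add p q) t
  eval-add []      q       t = +-identityˡ _
  eval-add (c ∷ p) []      t = +-identityʳ _
  eval-add (c ∷ p) (d ∷ q) t = begin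
    (c + t * eval p t) + (d + t * eval q t)  ≈⟨ solve 5 (λ c d t e f → (c :+ t :* e) :+ (d :+ t :* f) := (c :+ d) :+ t :* (e :+ f)) refl c d t _ _ ⟩
    (c + d) + t * (eval p t + eval q t)      ≈⟨ +-congˡ (*-congˡ (eval-add p q t)) ⟩
    (c + d) + t * eval (add p q) t           ∎

  mul : List Carrier → List Carrier → List Carrier
  mul []      q = []
  mul (c ∷ p) q = add (scale c q) (0# ∷ mul p q)

  eval-mul : ∀ p q t → eval p t * eval q t ≈ eval (mul p q) t
  eval-mul []      q t = zeroˡ _
  eval-mul (c ∷ p) q t = begin
    (c + t * eval p t) * eval q t                     ≈⟨ solve 4 (λ c t e f → (c :+ t :* e) :* f := c :* f :+ t :* (e :* f)) refl c t _ _ ⟩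
    c * eval q t + t * (eval p t * eval q t)          ≈⟨ +-cong (eval-scale c q t) (*-congˡ (eval-mul p q t)) ⟩
    eval (scale c q) t + t * eval (mul p q) t         ≈⟨ +-congˡ (+-identityˡ _) ⟨
    eval (scale c q) t + (0# + t * eval (mul p q) t)  ≈⟨ eval-add (scale c q) (0# ∷ mul p q) t ⟩
    eval (mul (c ∷ p) q) t                            ∎

  poly-const : ∀ c → IsPoly (λ _ → c)
  poly-const c = c ∷ [] , λ t → sym (trans (+-congˡ (zeroʳ t)) (+-identityʳ c))

  poly-id : IsPoly id
  poly-id = 0# ∷ 1# ∷ [] , λ t → sym (begin
    0# + t * (1# + t * 0#)  ≈⟨ +-identityˡ _ ⟩
    t * (1# + t * 0#)       ≈⟨ *-congˡ (trans (+-congˡ (zeroʳ t)) (+-identityʳ 1#)) ⟩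
    t * 1#                  ≈⟨ *-identityʳ t ⟩
    t                       ∎)

  poly-+ : ∀ {g h} → IsPoly g → IsPoly h → IsPoly (λ t → g t + h t)
  poly-+ (p , g≈p) (q , h≈q) = add p q , λ t → trans (+-cong (g≈p t) (h≈q t)) (eval-add p q t)

  poly-* : ∀ {g h} → IsPoly g → IsPoly h → IsPoly (λ t → g t * h t)
  poly-* (p , g≈p) (q , h≈q) = mul p q , λ t → trans (*-cong (g≈p t) (h≈q t)) (eval-mul p q t)

  poly-neg : ∀ {h} → IsPoly h → IsPoly (λ t → - h t)
  poly-neg {h} hp with poly-* (poly-const (- 1#)) hp
  ... | q , eq = q , λ t → trans (trans (-‿cong (sym (*-identityˡ _))) (-‿distribˡ-* 1# (h t))) (eq t)

  poly-Σ : ∀ n {h : Fin n → Carrier → Carrier} → (∀ i → IsPoly (h i)) →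
           IsPoly (λ t → Σ[ n ] (λ i → h i t))
  poly-Σ zero    hp = poly-const 0#
  poly-Σ (suc n) hp = poly-+ (hp zero) (poly-Σ n (hp ∘ suc))

  0≤-* : ∀ {a b t} → 0# ≤ t → a ≤ b → (t * a) ≤ (t * b)
  0≤-* {a} {b} {t} 0≤t a≤b = ≤-resp (+-identityˡ _) cancel (+-mono (t * a) (*-nonneg 0≤t 0≤b-a))
    where
    0≤b-a : 0# ≤ (b + - a)
    0≤b-a = ≤-resp (-‿inverseʳ a) refl (+-mono (- a) a≤b)
    cancel : t * (b + - a) + t * a ≈ t * b
    cancel = begin
      t * (b + - a) + t * a   ≈⟨ distribˡ t _ a ⟨
      t * ((b + - a) + a)     ≈⟨ *-congˡ (trans (+-assoc b _ a) (trans (+-congˡ (-‿inverseˡ a)) (+-identityʳ b))) ⟩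
      t * b                   ∎

  -- Induction on Horner's form. If the tail vanishes identically, the polynomial is its constant
  -- term. Otherwise the `C` of the tail serves again, since `C` times the polynomial is at least
  -- `C * c + t` for large `t`; in effect `C` inverts the last nonzero coefficient.
  eval-dichotomy : ∀ p → (∀ t → eval p t ≈ 0#) ⊎ ∃[ C ] Eventually (λ t → 1# ≤ (C * eval p t))
  eval-dichotomy [] = inj₁ λ t → refl
  eval-dichotomy (c ∷ p) with eval-dichotomy p
  ... | inj₁ p≈0 with ≈0? c
  ...   | yes c≈0 = inj₁ λ t → trans (+-cong c≈0 (trans (*-congˡ (p≈0 t)) (zeroʳ t))) (+-identityˡ 0#)
  ...   | no  c≉0 with inverse c c≉0
  ...     | C , cC≈1 = inj₂ (C , eventually-pure λ t → ≤-resp refl (sym (begin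
    C * (c + t * eval p t)  ≈⟨ *-congˡ (trans (+-congˡ (trans (*-congˡ (p≈0 t)) (zeroʳ t))) (+-identityʳ c)) ⟩
    C * c                   ≈⟨ *-comm C c ⟩
    c * C                   ≈⟨ cC≈1 ⟩
    1#                      ∎)) ≤-refl)
  eval-dichotomy (c ∷ p) | inj₂ (C , ev) =
    inj₂ (C , eventually-map bound (eventually-× ev (eventually-× (0# , λ _ z → z) (1# + - (C * c) , λ _ z → z))))
    where
    bound : ∀ t → (1# ≤ (C * eval p t)) × (0# ≤ t) × ((1# + - (C * c)) ≤ t) → 1# ≤ (C * (c + t * eval p t))
    bound t (1≤Cp , 0≤t , large) = ≤-trans 1≤t+Cc (≤-resp refl rearrange (+-mono (C * c) t≤tCp))
      where
      1≤t+Cc : 1# ≤ (t + C * c)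
      1≤t+Cc = ≤-resp (trans (+-assoc 1# _ _) (trans (+-congˡ (-‿inverseˡ _)) (+-identityʳ 1#))) refl
                      (+-mono (C * c) large)
      t≤tCp : t ≤ (t * (C * eval p t))
      t≤tCp = ≤-resp (*-identityʳ t) refl (0≤-* 0≤t 1≤Cp)
      rearrange : t * (C * eval p t) + C * c ≈ C * (c + t * eval p t)
      rearrange = solve 4 (λ t C e c → t :* (C :* e) :+ C :* c := C :* (c :+ t :* e)) refl t C _ c

  poly-nonzero : ∀ {h} → IsPoly h → ∀ {t₀} → h t₀ ≉ 0# → Eventually (λ t → h t ≉ 0#)
  poly-nonzero (p , h≈p) {t₀} h≉0 with eval-dichotomy p
  ... | inj₁ p≈0      = contradiction (trans (h≈p t₀) (p≈0 t₀)) h≉0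
  ... | inj₂ (C , ev) = eventually-map (λ t 1≤Cp h≈0 → 1≰0 (≤-resp refl
    (trans (*-congˡ (trans (sym (h≈p t)) h≈0)) (zeroʳ C)) 1≤Cp)) ev

-- Vectors and Gram-Schmidt projections.

module Projections (ℝ : CompleteOrderedField) (d : ℕ) where
  open Sums ℝ public
  open Solver using (solve; _:=_; _:+_; _:*_)

  Vector : Set
  Vector = Fin d → Carrier

  infix 4 _≋_
  _≋_ : Vector → Vector → Set
  x ≋ y = ∀ i → x i ≈ y i

  infixr 7 _•_
  _•_ : Carrier → Vector → Vector
  (a • x) i = a * x i

  infixl 6 _⊕_
  _⊕_ : Vector → Vector → Vector
  (x ⊕ y) i = x i + y i

  dot : Vector → Vector → Carrier
  dot x y = Σ[ d ] (λ i → x i * y i)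

  dot-cong : ∀ {x x' y y'} → x ≋ x' → y ≋ y' → dot x y ≈ dot x' y'
  dot-cong x≋x' y≋y' = Σ-cong d λ i → *-cong (x≋x' i) (y≋y' i)

  dot-comm : ∀ x y → dot x y ≈ dot y x
  dot-comm x y = Σ-cong d λ i → *-comm (x i) (y i)

  dot-• : ∀ a z x → dot z (a • x) ≈ a * dot z x
  dot-• a z x = trans (Σ-cong d λ i → solve 3 (λ z a x → z :* (a :* x) := a :* (z :* x)) refl (z i) a (x i))
                      (Σ-* d a _)

  dot-⊕ : ∀ z x y → dot z (x ⊕ y) ≈ dot z x + dot z y
  dot-⊕ z x y = trans (Σ-cong d λ i → distribˡ (z i) (x i) (y i)) (Σ-+ d _ _)

  dot-lin : ∀ a b z x y → dot z (a • x ⊕ b • y) ≈ a * dot z x + b * dot z y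
  dot-lin a b z x y = trans (dot-⊕ z (a • x) (b • y)) (+-cong (dot-• a z x) (dot-• b z y))

  dot-•• : ∀ {a b x x' y y'} → x' ≋ a • x → y' ≋ b • y → dot x' y' ≈ (a * b) * dot x y
  dot-•• {a} {b} {x} {x'} {y} {y'} x'≋ax y'≋by = begin
    dot x' y'              ≈⟨ dot-cong x'≋ax y'≋by ⟩
    dot (a • x) (b • y)    ≈⟨ dot-• b (a • x) y ⟩
    b * dot (a • x) y      ≈⟨ *-congˡ (trans (dot-comm (a • x) y) (dot-• a y x)) ⟩
    b * (a * dot y x)      ≈⟨ *-congˡ (*-congˡ (dot-comm y x)) ⟩
    b * (a * dot x y)      ≈⟨ solve 3 (λ a b e → b :* (a :* e) := (a :* b) :* e) refl a b _ ⟩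
    (a * b) * dot x y      ∎

  -- Division-free Gram–Schmidt: proj ws y is δ ws times the projection of y
  -- onto the orthogonal complement of ws, and δ ws ≉ 0 expresses that ws is
  -- linearly independent.
  proj : List Vector → Vector → Vector
  proj []       y = y
  proj (w ∷ ws) y = dot q q • proj ws y ⊕ (- dot q (proj ws y)) • q
    where q = proj ws w

  δ : List Vector → Carrier
  δ []       = 1#
  δ (w ∷ ws) = dot (proj ws w) (proj ws w) * δ ws

  -- Projection is self-adjoint, so a vector orthogonal to `ws` sees only the factor `δ ws`. Taking
  -- `z` to be a projection expresses its squared length through the unprojected vector.
  proj-adjoint : ∀ ws {z} y → All (λ w → dot z w ≈ 0#) ws → dot z (proj ws y) ≈ δ ws * dot z y
  proj-adjoint []       {z} y []         = sym (*-identityˡ _)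
  proj-adjoint (w ∷ ws) {z} y (zw ∷ zws) = begin
    dot z (proj (w ∷ ws) y)                                       ≈⟨ dot-lin (dot q q) (- dot q y') z y' q ⟩
    dot q q * dot z y' + - dot q y' * dot z q                     ≈⟨ +-cong (*-congˡ (proj-adjoint ws y zws)) (*-congˡ zq≈0) ⟩
    dot q q * (δ ws * dot z y) + - dot q y' * 0#                  ≈⟨ +-cong (sym (*-assoc _ _ _)) (zeroʳ _) ⟩
    (dot q q * δ ws) * dot z y + 0#                               ≈⟨ +-identityʳ _ ⟩
    (dot q q * δ ws) * dot z y                                    ∎
    where
    q = proj ws w
    y' = proj ws y
    zq≈0 : dot z q ≈ 0#
    zq≈0 = trans (proj-adjoint ws w zws) (trans (*-congˡ zw) (zeroʳ _))

  -- Against `ws` both summands vanish by induction; against `w`, `proj-adjoint` makes them cancel.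
  -- Nothing is divided, so dependent lists are covered as well, and whole curves can be kept
  -- orthogonal.
  proj-⊥ : ∀ ws y → All (λ w → dot (proj ws y) w ≈ 0#) ws
  proj-⊥ []       y = []
  proj-⊥ (w ∷ ws) y = head ∷ All.zipWith tail (proj-⊥ ws w , proj-⊥ ws y)
    where
    q = proj ws w
    y' = proj ws y
    expand : ∀ z → dot (proj (w ∷ ws) y) z ≈ dot q q * dot y' z + - dot q y' * dot q z
    expand z = trans (dot-comm _ z) (trans (dot-lin (dot q q) (- dot q y') z y' q)
                 (+-cong (*-congˡ (dot-comm z y')) (*-congˡ (dot-comm z q))))
    tail : ∀ {z} → dot q z ≈ 0# × dot y' z ≈ 0# → dot (proj (w ∷ ws) y) z ≈ 0#
    tail {z} (qz , y'z) = begin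
      dot (proj (w ∷ ws) y) z                       ≈⟨ expand z ⟩
      dot q q * dot y' z + - dot q y' * dot q z     ≈⟨ +-cong (*-congˡ y'z) (*-congˡ qz) ⟩
      dot q q * 0# + - dot q y' * 0#                ≈⟨ +-cong (zeroʳ _) (zeroʳ _) ⟩
      0# + 0#                                       ≈⟨ +-identityˡ 0# ⟩
      0#                                            ∎
    qq : dot q q ≈ δ ws * dot q w
    qq = proj-adjoint ws w (proj-⊥ ws w)
    qy' : dot q y' ≈ δ ws * dot y' w
    qy' = trans (dot-comm q y') (proj-adjoint ws w (proj-⊥ ws y))
    head : dot (proj (w ∷ ws) y) w ≈ 0#
    head = begin
      dot (proj (w ∷ ws) y) w                                    ≈⟨ expand w ⟩
      dot q q * dot y' w + - dot q y' * dot q w                  ≈⟨ +-congˡ (-‿distribˡ-* _ _) ⟨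
      dot q q * dot y' w + - (dot q y' * dot q w)                ≈⟨ +-cong (*-congʳ qq) (-‿cong (*-congʳ qy')) ⟩
      δ ws * dot q w * dot y' w + - (δ ws * dot y' w * dot q w)  ≈⟨ +-congʳ (solve 3 (λ a b c → a :* b :* c := a :* c :* b) refl (δ ws) _ _) ⟩
      δ ws * dot y' w * dot q w + - (δ ws * dot y' w * dot q w)  ≈⟨ -‿inverseʳ _ ⟩
      0#                                                         ∎

  proj-fix : ∀ ws {y} → All (λ w → dot y w ≈ 0#) ws → proj ws y ≋ δ ws • y
  proj-fix []       {y} []         i = sym (*-identityˡ _)
  proj-fix (w ∷ ws) {y} (yw ∷ yws) i = begin
    dot q q * y' i + - dot q y' * q i      ≈⟨ +-cong (*-congˡ (proj-fix ws yws i)) (*-congʳ (-‿cong qy'≈0)) ⟩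
    dot q q * (δ ws * y i) + - 0# * q i    ≈⟨ +-congˡ (trans (*-congʳ -0#≈0#) (zeroˡ _)) ⟩
    dot q q * (δ ws * y i) + 0#            ≈⟨ trans (+-identityʳ _) (sym (*-assoc _ _ _)) ⟩
    (dot q q * δ ws) * y i                 ∎
    where
    q = proj ws w
    y' = proj ws y
    qy'≈0 : dot q y' ≈ 0#
    qy'≈0 = begin
      dot q y'               ≈⟨ dot-cong (λ _ → refl) (proj-fix ws yws) ⟩
      dot q (δ ws • y)       ≈⟨ dot-• (δ ws) q y ⟩
      δ ws * dot q y         ≈⟨ *-congˡ (trans (dot-comm q y) (proj-adjoint ws w yws)) ⟩
      δ ws * (δ ws * dot y w) ≈⟨ *-congˡ (trans (*-congˡ yw) (zeroʳ _)) ⟩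
      δ ws * 0#              ≈⟨ zeroʳ _ ⟩
      0#                     ∎

  -- Rescalings, polynomial families and open conditions.

  module _ {V : Set} where

    Rescaling : (V → Vector) → (V → Vector) → Set
    Rescaling h e = ∀ v → ∃[ a ] (a ≉ 0# × h v ≋ a • e v)

    -- Division-free projection is homogeneous in each vector of the list. The factor `κ` depends on
    -- the list alone, so one `κ` serves every projected vector and `δ`.
    proj-rescale : ∀ {h e} → Rescaling h e → ∀ T → ∃[ κ ] (κ ≉ 0# ×
                   (∀ {a y y'} → y' ≋ a • y → proj (map h T) y' ≋ (κ * a) • proj (map e T) y) ×
                   δ (map h T) ≈ κ * δ (map e T))
    proj-rescale r [] = 1# , nontrivial ,
      (λ y'≋ay i → trans (y'≋ay i) (*-congʳ (sym (*-identityˡ _)))) , sym (*-identityˡ 1#)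
    proj-rescale {h} {e} r (v ∷ T) with proj-rescale r T | r v
    ... | κ , κ≉0 , scaled , δ-scaled | a , a≉0 , hv≋aev =
      -- The two occurrences of `q` in each summand contribute `κ * a` each, and the projection or
      -- `δ` of the shorter list contributes one more `κ`.
      ((κ * a) * (κ * a)) * κ , *-nonzero (*-nonzero κa≉0 κa≉0) κ≉0 , scaled' , (begin
        dot q' q' * δ (map h T)                                  ≈⟨ *-cong q'q' δ-scaled ⟩
        ((κ * a) * (κ * a)) * dot q q * (κ * δ (map e T))        ≈⟨ solve 4 (λ s o k x → s :* o :* (k :* x) := (s :* k) :* (o :* x)) refl _ (dot q q) κ _ ⟩
        ((κ * a) * (κ * a)) * κ * (dot q q * δ (map e T))        ∎)
      where
      q' = proj (map h T) (h v)
      q = proj (map e T) (e v)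
      κa≉0 = *-nonzero κ≉0 a≉0
      q'≋q : q' ≋ (κ * a) • q
      q'≋q = scaled hv≋aev
      q'q' : dot q' q' ≈ ((κ * a) * (κ * a)) * dot q q
      q'q' = dot-•• q'≋q q'≋q
      scaled' : ∀ {b y y'} → y' ≋ b • y →
                proj (map h (v ∷ T)) y' ≋ (((κ * a) * (κ * a)) * κ * b) • proj (map e (v ∷ T)) y
      scaled' {b} {y} {y'} y'≋by i = begin
        dot q' q' * z' i + - dot q' z' * q' i
          ≈⟨ +-cong (*-cong q'q' (z'≋z i)) (*-cong (-‿cong (dot-•• q'≋q z'≋z)) (q'≋q i)) ⟩
        ((κ * a) * (κ * a)) * dot q q * ((κ * b) * z i) + - (((κ * a) * (κ * b)) * dot q z) * ((κ * a) * q i)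
          ≈⟨ +-congˡ (*-congʳ (-‿distribʳ-* _ _)) ⟩
        ((κ * a) * (κ * a)) * dot q q * ((κ * b) * z i) + (((κ * a) * (κ * b)) * - dot q z) * ((κ * a) * q i)
          ≈⟨ solve 7 (λ k a b o m zi qi → ((k :* a) :* (k :* a)) :* o :* ((k :* b) :* zi) :+ (((k :* a) :* (k :* b)) :* m) :* ((k :* a) :* qi)
                      := (((k :* a) :* (k :* a)) :* k :* b) :* (o :* zi :+ m :* qi)) refl κ a b (dot q q) (- dot q z) (z i) (q i) ⟩
        (((κ * a) * (κ * a)) * κ * b) * (dot q q * z i + - dot q z * q i)
          ∎
        where
        z' = proj (map h T) y'
        z = proj (map e T) y
        z'≋z : z' ≋ (κ * b) • z
        z'≋z = scaled y'≋by

    PolyFamily : (Carrier → V → Vector) → Set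
    PolyFamily h = ∀ v i → IsPoly (λ t → h t v i)

    PolyVector : (Carrier → Vector) → Set
    PolyVector y = ∀ i → IsPoly (λ t → y t i)

    dot-poly : ∀ {x y} → PolyVector x → PolyVector y → IsPoly (λ t → dot (x t) (y t))
    dot-poly xp yp = poly-Σ d λ i → poly-* (xp i) (yp i)

    proj-poly : ∀ {h} → PolyFamily h → ∀ T {y} → PolyVector y → PolyVector (λ t → proj (map (h t) T) (y t))
    proj-poly hp []      yp = yp
    proj-poly {h} hp (v ∷ T) yp i =
      poly-+ (poly-* (dot-poly qp qp) (y'p i)) (poly-* (poly-neg (dot-poly qp y'p)) (qp i))
      where
      qp = proj-poly hp T (hp v)
      y'p = proj-poly hp T yp

    δ-poly : ∀ {h} → PolyFamily h → ∀ T → IsPoly (λ t → δ (map (h t) T))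
    δ-poly hp []      = poly-const 1#
    δ-poly hp (v ∷ T) = poly-* (dot-poly qp qp) (δ-poly hp T)
      where qp = proj-poly hp T (hp v)

    -- Openness along polynomial curves. The conclusion speaks of large parameters rather than of
    -- ones near `t₀`, so that conditions read off at different points of a curve can be combined.
    Open : ((V → Vector) → Set) → Set
    Open P = ∀ {e} → P e → ∀ {h} → PolyFamily h → ∀ t₀ → Rescaling (h t₀) e → Eventually (λ t → P (h t))

    open-δ : ∀ T → Open (λ f → δ (map f T) ≉ 0#)
    open-δ T {e} δ≉0 hp t₀ r with proj-rescale r T
    ... | κ , κ≉0 , _ , eq = poly-nonzero (δ-poly hp T) (≉-resp (sym eq) (*-nonzero κ≉0 δ≉0))

    open-dot : ∀ u v → Open (λ f → dot (f u) (f v) ≉ 0#)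
    open-dot u v ≉0 hp t₀ r with r u | r v
    ... | a , a≉0 , hu | b , b≉0 , hv = poly-nonzero (dot-poly (hp u) (hp v))
      (≉-resp (sym (dot-•• hu hv)) (*-nonzero (*-nonzero a≉0 b≉0) ≉0))

    open-× : ∀ {P Q} → Open P → Open Q → Open (λ f → P f × Q f)
    open-× oP oQ (p , q) hp t₀ r = eventually-× (oP p hp t₀ r) (oQ q hp t₀ r)

    open-All : ∀ {X : Set} {P : X → (V → Vector) → Set} → (∀ x → Open (P x)) →
               ∀ Z → Open (λ f → All (λ x → P x f) Z)
    open-All oP []      []       hp t₀ r = eventually-pure λ _ → []
    open-All oP (z ∷ Z) (p ∷ ps) hp t₀ r =
      eventually-map (λ _ (q , qs) → q ∷ qs) (eventually-× (oP z p hp t₀ r) (open-All oP Z ps hp t₀ r))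

    open-→ : ∀ {H P} → Dec H → Open P → Open (λ f → H → P f)
    open-→ (yes h) oP p hp t₀ r = eventually-map (λ _ q _ → q) (oP (p h) hp t₀ r)
    open-→ (no ¬h) oP p hp t₀ r = eventually-pure λ _ h → contradiction h ¬h

-- Orthogonal representations

module _ {n : ℕ} where
  open DecMembership (_≟_ {n}) using (_∈?_)

  infixl 6 _∖_
  _∖_ : List (Fin n) → Fin n → List (Fin n)
  M ∖ z = filter (λ x → ¬? (x ≟ z)) M

  ∈-∖⁺ : ∀ {M x z} → x ∈ M → x ≢ z → x ∈ M ∖ z
  ∈-∖⁺ = ∈-filter⁺ _

  ∈-∖⁻ : ∀ {M x z} → x ∈ M ∖ z → x ∈ M × x ≢ z
  ∈-∖⁻ = ∈-filter⁻ _

  ∖-unique : ∀ {M z} → Unique M → Unique (M ∖ z)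
  ∖-unique = Unique.filter⁺ _

  length-∖ : ∀ {M z} → z ∈ M → length (M ∖ z) ℕ.< length M
  length-∖ {M} z∈M = filter-notAll _ M (Any.map (λ { ≡.refl p → p ≡.refl }) z∈M)

  ∉⇒All≢ : ∀ {x : Fin n} {M} → x ∉ M → All (x ≢_) M
  ∉⇒All≢ x∉M = All.tabulate λ { y∈M ≡.refl → x∉M y∈M }

  length-⊆ : ∀ {xs ys : List (Fin n)} → Unique xs → (∀ {x} → x ∈ xs → x ∈ ys) → length xs ℕ.≤ length ys
  length-⊆ []               _     = ℕ.z≤n
  length-⊆ {x ∷ xs} {ys} (x∉xs ∷ u) xs⊆ys =
    ℕ.<-≤-trans (ℕ.s≤s (length-⊆ u λ y∈xs → ∈-∖⁺ (xs⊆ys (there y∈xs)) λ y≡x → All.lookup x∉xs y∈xs (≡.sym y≡x)))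
                (length-∖ (xs⊆ys (here ≡.refl)))

  z∉M∖z : ∀ {M} {z : Fin n} → z ∉ M ∖ z
  z∉M∖z {M} z∈ = proj₂ (∈-∖⁻ {M = M} z∈) ≡.refl

  ∷∖-unique : ∀ {M} {z : Fin n} → Unique M → Unique (z ∷ M ∖ z)
  ∷∖-unique {M} u = ∉⇒All≢ (z∉M∖z {M}) ∷ ∖-unique u

  ∷∖-⊇ : ∀ {M} {z x : Fin n} → x ∈ M → x ∈ z ∷ M ∖ z
  ∷∖-⊇ {z = z} {x} x∈M with x ≟ z
  ... | yes ≡.refl = here ≡.refl
  ... | no x≢z    = there (∈-∖⁺ x∈M x≢z)

  ∷∖-⊆ : ∀ {M} {z x : Fin n} → z ∈ M → x ∈ z ∷ M ∖ z → x ∈ M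
  ∷∖-⊆ z∈M (here ≡.refl) = z∈M
  ∷∖-⊆ {M} z∈M (there x∈) = proj₁ (∈-∖⁻ {M = M} x∈)

  longer⇒∃∉ : ∀ {M T : List (Fin n)} → Unique M → length T ℕ.< length M → ∃[ z ] (z ∈ M × z ∉ T)
  longer⇒∃∉ {M} {T} u T<M with Any.any? (λ z → ¬? (z ∈? T)) M
  ... | yes p = find p
  ... | no ¬p = contradiction (length-⊆ u M⊆T) (ℕ.<⇒≱ T<M)
    where
    M⊆T : ∀ {x} → x ∈ M → x ∈ T
    M⊆T {x} x∈M with x ∈? T
    ... | yes x∈T = x∈T
    ... | no x∉T  = contradiction (Any.map (λ { ≡.refl → x∉T }) x∈M) ¬p

-- Here `d` stands for n - k, and the two last parameters are the consequences of k-connectivity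
-- that the construction uses.
module Representations (ℝ : CompleteOrderedField) {n : ℕ} (G : Graph n) (d : ℕ)
  (few-nonneighbours : ∀ c T → Unique T → (∀ {b} → b ∈ T → b ≢ c × ¬ Edge G c b) → length T ℕ.< d)
  (connected : ∀ M → Unique M → d ℕ.< length M → ∀ Z → (∀ {z} → z ∈ Z → z ∈ M) → ∀ {z} → z ∈ Z →
               (∀ {i j} → i ∈ Z → j ∈ M → Edge G i j → j ∈ Z) → ∀ {w} → w ∈ M → w ∈ Z)
  where
  open Projections ℝ d public
  open DecMembership (_≟_ {n}) using (_∈?_)
  open DecUnique (_≟_ {n}) using (unique?)

  V : Set
  V = Fin n

  adjacent-sym : ∀ {i j} → Edge G i j → Edge G j i
  adjacent-sym {i} {j} = ≡.subst T (adj-sym G i j)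

  ≡⇒≋ : ∀ {x y : Vector} → x ≡ y → x ≋ y
  ≡⇒≋ ≡.refl i = refl

  infixl 10 _[_≔_]
  _[_≔_] : (V → Vector) → V → Vector → V → Vector
  (f [ c ≔ x ]) v = if does (v ≟ c) then x else f v

  update-≡ : ∀ f c x → (f [ c ≔ x ]) c ≡ x
  update-≡ f c x rewrite dec-true (c ≟ c) ≡.refl = ≡.refl

  update-≢ : ∀ f {c} x {v} → v ≢ c → (f [ c ≔ x ]) v ≡ f v
  update-≢ f {c} x {v} v≢c rewrite dec-false (v ≟ c) v≢c = ≡.refl

  update-map : ∀ f {c} x {T} → c ∉ T → map (f [ c ≔ x ]) T ≡ map f T
  update-map f x c∉T = map-cong-local (All.map (λ c≢v → update-≢ f x (c≢v ∘ ≡.sym)) (∉⇒All≢ c∉T))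

  nonneighbours : V → List V → List V
  nonneighbours c = filter (λ b → ¬? (T? (adj G c b)))

  ∈-nonneighbours⁻ : ∀ {c} L {b} → b ∈ nonneighbours c L → b ∈ L × ¬ Edge G c b
  ∈-nonneighbours⁻ {c} L = ∈-filter⁻ (λ b → ¬? (T? (adj G c b))) {xs = L}

  nonneighbours-⊆ : ∀ {c} L {b} → b ∈ nonneighbours c L → b ∈ L
  nonneighbours-⊆ L = proj₁ ∘ ∈-nonneighbours⁻ L

  nonneighbours-bound : ∀ {c L} → Unique L → c ∉ L → length (nonneighbours c L) ℕ.< d
  nonneighbours-bound {L = L} u c∉L = few-nonneighbours _ _ (Unique.filter⁺ _ u) λ b∈ →
    (λ { ≡.refl → c∉L (nonneighbours-⊆ L b∈) }) , proj₂ (∈-nonneighbours⁻ L b∈)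

  Orthogonal : (V → Vector) → List V → Set
  Orthogonal f M = ∀ {a b} → a ∈ M → b ∈ M → a ≢ b → ¬ Edge G a b → dot (f a) (f b) ≈ 0#

  orthogonal-⊆ : ∀ {f M M'} → (∀ {x} → x ∈ M' → x ∈ M) → Orthogonal f M → Orthogonal f M'
  orthogonal-⊆ M'⊆M o a∈ b∈ = o (M'⊆M a∈) (M'⊆M b∈)

  update-orthogonal : ∀ {f c x M} → Orthogonal f M →
    (∀ {b} → b ∈ M → b ≢ c → ¬ Edge G c b → dot x (f b) ≈ 0#) →
    ∀ {M'} → (∀ {v} → v ∈ M' → v ≢ c → v ∈ M) → Orthogonal (f [ c ≔ x ]) M'
  update-orthogonal {f} {c} {x} o x⊥ M'⊆M {a} {b} a∈ b∈ a≢b ¬ab with a ≟ c | b ≟ c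
  ... | yes ≡.refl | yes ≡.refl = contradiction ≡.refl a≢b
  ... | yes ≡.refl | no b≢c    = x⊥ (M'⊆M b∈ b≢c) b≢c ¬ab
  ... | no a≢c    | yes ≡.refl = trans (dot-comm _ x) (x⊥ (M'⊆M a∈ a≢c) a≢c (¬ab ∘ adjacent-sym))
  ... | no a≢c    | no b≢c    = o (M'⊆M a∈ a≢c) (M'⊆M b∈ b≢c) a≢b ¬ab

  -- Lists are read from the right: the head is chosen last. Independence of the earlier
  -- nonneighbours' vectors keeps the projection at each choice from collapsing.
  Nondegenerate : (V → Vector) → List V → Set
  Nondegenerate f []      = ⊤
  Nondegenerate f (c ∷ L) = δ (map f (nonneighbours c L)) ≉ 0# × Nondegenerate f L

  interpolate : (f g : V → Vector) → Carrier → V → Vector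
  interpolate f g t v = (1# + - t) • f v ⊕ t • g v

  -- Passes, up to scaling of the vectors, through f at 0 and through g at 1.
  curve : (f g : V → Vector) → List V → Carrier → V → Vector
  curve f g []      t = interpolate f g t
  curve f g (c ∷ L) t =
    curve f g L t [ c ≔ proj (map (curve f g L t) (nonneighbours c L)) (interpolate f g t c) ]

  interpolate-poly : ∀ f g → PolyFamily (interpolate f g)
  interpolate-poly f g v i =
    poly-+ (poly-* (poly-+ (poly-const 1#) (poly-neg poly-id)) (poly-const (f v i)))
           (poly-* poly-id (poly-const (g v i)))

  curve-poly : ∀ f g L → PolyFamily (curve f g L)
  curve-poly f g []      v i = interpolate-poly f g v i
  curve-poly f g (c ∷ L) v i with v ≟ c
  ... | yes _ = proj-poly (curve-poly f g L) (nonneighbours c L) (interpolate-poly f g c) i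
  ... | no  _ = curve-poly f g L v i

  curve-orthogonal : ∀ f g {L} → Unique L → ∀ t → Orthogonal (curve f g L t) L
  curve-orthogonal f g {c ∷ L} (c∉L ∷ u) t = update-orthogonal (curve-orthogonal f g u t)
    (λ b∈L _ ¬cb → All.lookup (All.map⁻ (proj-⊥ (map h (nonneighbours c L)) (interpolate f g t c)))
                              (∈-filter⁺ _ b∈L ¬cb))
    (λ { (here ≡.refl) v≢c → contradiction ≡.refl v≢c ; (there v∈L) _ → v∈L })
    where h = curve f g L t

  -- Where the interpolation equals `e`, each vector is already orthogonal to its earlier
  -- nonneighbours, so projecting only multiplies it by a `δ`, nonzero by nondegeneracy.
  curve-through : ∀ f g {t e} → (∀ v → interpolate f g t v ≋ 1# • e v) →
                  ∀ L → Unique L → Orthogonal e L → Nondegenerate e L → Rescaling (curve f g L t) e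
  curve-through f g through []      _         _ _ v = 1# , nontrivial , through v
  curve-through f g {t} {e} through (c ∷ L) (c∉L ∷ u) o (δ≉0 , nd) v with v ≟ c
  ... | no _ = curve-through f g through L u (orthogonal-⊆ there o) nd v
  ... | yes ≡.refl with proj-rescale (curve-through f g through L u (orthogonal-⊆ there o) nd) (nonneighbours c L)
  ...   | κ , κ≉0 , scaled , _ = (κ * 1#) * δ ws , *-nonzero (*-nonzero κ≉0 nontrivial) δ≉0 , λ i →
          trans (scaled (through c) i) (trans (*-congˡ (proj-fix ws ⊥ws i)) (sym (*-assoc _ _ _)))
    where
    ws = map e (nonneighbours c L)
    ⊥ws : All (λ w → dot (e c) w ≈ 0#) ws
    ⊥ws = All.map⁺ (All.tabulate λ b∈ → let b∈L , ¬cb = ∈-nonneighbours⁻ L b∈ in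
            o (here ≡.refl) (there b∈L) (All.lookup c∉L b∈L) ¬cb)

  -- `P` is read off at 0 and `Q` at 1; both being open, they hold together for all large parameters
  -- of the curve.
  combine : ∀ {P Q f g} L → Unique L → Orthogonal f L → Nondegenerate f L → Orthogonal g L → Nondegenerate g L →
            Open P → Open Q → P f → Q g → ∃[ h ] (Orthogonal h L × P h × Q h)
  combine {f = f} {g} L u of nf og ng oP oQ p q with eventually-∃ (eventually-×
    (oP p (curve-poly f g L) 0# (curve-through f g at-0 L u of nf))
    (oQ q (curve-poly f g L) 1# (curve-through f g at-1 L u og ng)))
    where
    at-0 : ∀ v → interpolate f g 0# v ≋ 1# • f v
    at-0 v i = trans (+-cong (*-congʳ (trans (+-congˡ -0#≈0#) (+-identityʳ 1#))) (zeroˡ _)) (+-identityʳ _)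
    at-1 : ∀ v → interpolate f g 1# v ≋ 1# • g v
    at-1 v i = trans (+-congʳ (trans (*-congʳ (-‿inverseʳ 1#)) (zeroˡ _))) (+-identityˡ _)
  ... | t , ph , qh = curve f g L t , curve-orthogonal f g u t , ph , qh

  -- The requirements on `T` form one decidable conjunction, so that `open-→` applies to it.
  GeneralPosition : (V → Vector) → List V → Set
  GeneralPosition f M = ∀ T → length T ℕ.≤ d × Unique T × All (_∈ M) T → δ (map f T) ≉ 0#

  open-GeneralPosition : ∀ M → Open (λ f → GeneralPosition f M)
  open-GeneralPosition M gp hp t₀ r =
    eventually-map (λ t q T h → q T (proj₁ h) h) (eventually-List d λ T →
      open-→ (length T ℕ.≤? d ×-dec unique? T ×-dec All.all? (_∈? M) T) (open-δ T) (gp T) hp t₀ r)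

  generalPosition-⊆ : ∀ {f M M'} → (∀ {x} → x ∈ M' → x ∈ M) → GeneralPosition f M → GeneralPosition f M'
  generalPosition-⊆ M'⊆M gp T (len , u , T⊆M') = gp T (len , u , All.map M'⊆M T⊆M')

  generalPosition-update : ∀ {f c x M} → GeneralPosition f M → c ∉ M → GeneralPosition (f [ c ≔ x ]) M
  generalPosition-update {f} {c} {x} gp c∉M T h@(_ , _ , T⊆M) =
    ≡.subst (λ ws → δ ws ≉ 0#) (≡.sym (update-map f x λ c∈T → c∉M (All.lookup T⊆M c∈T))) (gp T h)

  generalPosition-nonneighbours : ∀ {f M c L} → GeneralPosition f M → Unique L → c ∉ L →
    (∀ {x} → x ∈ nonneighbours c L → x ∈ M) → δ (map f (nonneighbours c L)) ≉ 0#
  generalPosition-nonneighbours gp u c∉L ⊆M =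
    gp _ (ℕ.<⇒≤ (nonneighbours-bound u c∉L) , Unique.filter⁺ _ u , All.tabulate ⊆M)

  generalPosition⇒nondegenerate : ∀ {f M} → GeneralPosition f M → ∀ L → Unique L →
                                  (∀ {x} → x ∈ L → x ∈ M) → Nondegenerate f L
  generalPosition⇒nondegenerate gp []      _         _   = tt
  generalPosition⇒nondegenerate gp (c ∷ L) (c∉L ∷ u) ⊆M =
    generalPosition-nonneighbours gp u (λ c∈L → All.lookup c∉L c∈L ≡.refl) (⊆M ∘ there ∘ nonneighbours-⊆ L) ,
    generalPosition⇒nondegenerate gp L u (⊆M ∘ there)

  -- With `z` chosen last, no choice projects off the vector of `z`, so independence is asked only
  -- among the vectors of the other vertices.
  deleted⇒nondegenerate : ∀ {f M z} → Unique M → GeneralPosition f (M ∖ z) → Nondegenerate f (z ∷ M ∖ z)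
  deleted⇒nondegenerate {M = M} {z} u gp =
    generalPosition-nonneighbours gp (∖-unique u) (z∉M∖z {M = M}) (nonneighbours-⊆ (M ∖ z)) ,
    generalPosition⇒nondegenerate gp _ (∖-unique u) id

  Representation : List V → Set
  Representation M = ∃[ f ] (Orthogonal f M × GeneralPosition f M)

  -- Induction step for vertex sets larger than `d`.

  module Step (M : List V) (u : Unique M) (d<M : d ℕ.< length M)
              (smaller : ∀ {z} → z ∈ M → Representation (M ∖ z)) where

    Good : V → (V → Vector) → Set
    Good z f = GeneralPosition f (M ∖ z)

    good : ∀ {z} → z ∈ M → ∃[ f ] (Orthogonal f M × Good z f)
    good {z} z∈M = let f , o , gp = smaller z∈M in
      -- The zero vector is orthogonal to everything, and goodness at `z` never looks at the vector
      -- of `z`.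
      f [ z ≔ (λ _ → 0#) ] ,
      update-orthogonal o (λ _ _ _ → Σ-zero d λ i → zeroˡ _) ∈-∖⁺ ,
      generalPosition-update gp (z∉M∖z {M = M})

    -- Goodness at the same `z` makes both representations nondegenerate in the order that chooses
    -- `z` last.
    combine-good : ∀ {P Q f g z} → z ∈ M → Orthogonal f M → Orthogonal g M → Good z f → Good z g →
                   Open P → Open Q → P f → Q g → ∃[ h ] (Orthogonal h M × P h × Q h)
    combine-good {z = z} z∈M of og gf gg oP oQ p q =
      let h , oh , ph , qh = combine (z ∷ M ∖ z) (∷∖-unique u) (orthogonal-⊆ (∷∖-⊆ z∈M) of) (deleted⇒nondegenerate u gf)
                   (orthogonal-⊆ (∷∖-⊆ z∈M) og) (deleted⇒nondegenerate u gg) oP oQ p q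
      in h , orthogonal-⊆ ∷∖-⊇ oh , ph , qh

    -- The neighbour j of l imposes no condition on the vector of l, so in the
    -- order X, j, l both a j-good and an l-good representation are nondegenerate.
    good-adjacent : ∀ {j l} → j ∈ M → l ∈ M → Edge G j l →
                    ∃[ h ] (Orthogonal h M × Good j h × Good l h)
    good-adjacent {j} {l} j∈M l∈M jl =
      let h , oh , gj , gl = combine L uL (orthogonal-⊆ L⊆M of) nf (orthogonal-⊆ L⊆M og) ng
             (open-GeneralPosition (M ∖ j)) (open-GeneralPosition (M ∖ l)) gf gg
      in h , orthogonal-⊆ M⊆L oh , gj , gl
      where
      f = proj₁ (good j∈M)
      of = proj₁ (proj₂ (good j∈M))
      gf = proj₂ (proj₂ (good j∈M))
      g = proj₁ (good l∈M)
      og = proj₁ (proj₂ (good l∈M))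
      gg = proj₂ (proj₂ (good l∈M))
      j≢l : j ≢ l
      j≢l ≡.refl = ≡.subst T (irrefl G j) jl
      X = M ∖ l ∖ j
      L = l ∷ j ∷ X
      j∈M∖l : j ∈ M ∖ l
      j∈M∖l = ∈-∖⁺ j∈M j≢l
      tail⊆ : ∀ {x} → x ∈ j ∷ X → x ∈ M ∖ l
      tail⊆ = ∷∖-⊆ j∈M∖l
      l∉tail : l ∉ j ∷ X
      l∉tail l∈ = z∉M∖z {M = M} (tail⊆ l∈)
      u-tail : Unique (j ∷ X)
      u-tail = ∷∖-unique (∖-unique u)
      uL : Unique L
      uL = ∉⇒All≢ l∉tail ∷ u-tail
      L⊆M : ∀ {x} → x ∈ L → x ∈ M
      L⊆M (here ≡.refl) = l∈M
      L⊆M (there x∈)    = proj₁ (∈-∖⁻ {M = M} (tail⊆ x∈))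
      X⊆M∖j : ∀ {x} → x ∈ X → x ∈ M ∖ j
      X⊆M∖j x∈ = let x∈M∖l , x≢j = ∈-∖⁻ {M = M ∖ l} x∈ in ∈-∖⁺ (proj₁ (∈-∖⁻ {M = M} x∈M∖l)) x≢j
      l-tail⊆ : ∀ {x} → x ∈ nonneighbours l (j ∷ X) → x ∈ M ∖ j
      l-tail⊆ x∈ with ∈-nonneighbours⁻ (j ∷ X) x∈
      ... | here ≡.refl , ¬lj = contradiction (adjacent-sym jl) ¬lj
      ... | there x∈X   , _   = X⊆M∖j x∈X
      nf : Nondegenerate f L
      nf = generalPosition-nonneighbours gf u-tail l∉tail l-tail⊆ ,
           generalPosition-nonneighbours gf (∖-unique (∖-unique u)) (z∉M∖z {M = M ∖ l}) (X⊆M∖j ∘ nonneighbours-⊆ X) ,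
           generalPosition⇒nondegenerate gf X (∖-unique (∖-unique u)) X⊆M∖j
      ng : Nondegenerate g L
      ng = generalPosition-nonneighbours gg u-tail l∉tail (tail⊆ ∘ nonneighbours-⊆ (j ∷ X)) ,
           generalPosition⇒nondegenerate gg (j ∷ X) u-tail tail⊆
      M⊆L : ∀ {x} → x ∈ M → x ∈ L
      M⊆L x∈M with ∷∖-⊇ {z = l} x∈M
      ... | here x≡l   = here x≡l
      ... | there x∈   = there (∷∖-⊇ x∈)

    -- The edge yields a representation good at both `j` and `l`. It shares goodness at `j` with
    -- `f`, so the two combine, keeping all of `Z` from `f` and `l` from the other.
    add-good : ∀ {Z f j l} → Orthogonal f M → All (λ z → Good z f) Z → j ∈ Z → j ∈ M → l ∈ M → Edge G j l →
               ∃[ h ] (Orthogonal h M × All (λ z → Good z h) (l ∷ Z))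
    add-good {Z} {l = l} of goodZ j∈Z j∈M l∈M jl =
      let g , og , gj , gl = good-adjacent j∈M l∈M jl
          h , oh , goodZ' , gl' = combine-good j∈M of og (All.lookup goodZ j∈Z) gj
             (open-All (λ z → open-GeneralPosition (M ∖ z)) Z) (open-GeneralPosition (M ∖ l)) goodZ gl
      in h , oh , gl' ∷ goodZ'

    -- `Z` grows along edges leaving it; when none is left, connectedness makes it all of `M`. `W`
    -- covers the vertices still to be tried, and its length bounds the recursion.
    grow : ∀ fuel W Z → length W ℕ.≤ fuel → (∀ {x} → x ∈ M → x ∈ Z ⊎ x ∈ W) → (∀ {x} → x ∈ W → x ∈ M) →
           (∀ {x} → x ∈ Z → x ∈ M) → ∃[ z ] z ∈ Z → ∃[ f ] (Orthogonal f M × All (λ z → Good z f) Z) →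
           ∃[ f ] (Orthogonal f M × (∀ {z} → z ∈ M → Good z f))
    grow fuel W Z len cover W⊆M Z⊆M (z₀ , z₀∈Z) (f , of , goodZ)
      with Any.any? (λ l → Any.any? (λ j → T? (adj G j l)) Z) W
    ... | no none = f , of , λ z∈M → All.lookup goodZ (connected M u d<M Z Z⊆M z₀∈Z closed z∈M)
      where
      closed : ∀ {i j} → i ∈ Z → j ∈ M → Edge G i j → j ∈ Z
      closed i∈Z j∈M ij with cover j∈M
      ... | inj₁ j∈Z = j∈Z
      ... | inj₂ j∈W = contradiction (Any.map (λ { ≡.refl → Any.map (λ { ≡.refl → ij }) i∈Z }) j∈W) none
    ... | yes some with find some
    ...   | l , l∈W , some' with find some'
    ...     | j , j∈Z , jl with fuel
    ...       | zero = contradiction (ℕ.<-≤-trans (length-∖ l∈W) len) λ ()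
    ...       | suc fuel' = grow fuel' (W ∖ l) (l ∷ Z) (ℕ.s≤s⁻¹ (ℕ.<-≤-trans (length-∖ l∈W) len)) cover'
                (λ x∈ → W⊆M (proj₁ (∈-∖⁻ {M = W} x∈)))
                (λ { (here ≡.refl) → W⊆M l∈W ; (there x∈Z) → Z⊆M x∈Z }) (l , here ≡.refl)
                (add-good of goodZ j∈Z (Z⊆M j∈Z) (W⊆M l∈W) jl)
      where
      cover' : ∀ {x} → x ∈ M → x ∈ l ∷ Z ⊎ x ∈ W ∖ l
      cover' {x} x∈M with x ≟ l | cover x∈M
      ... | yes x≡l | _        = inj₁ (here x≡l)
      ... | no _    | inj₁ x∈Z = inj₁ (there x∈Z)
      ... | no x≢l  | inj₂ x∈W = inj₂ (∈-∖⁺ x∈W x≢l)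

    representation : Representation M
    representation =
      let z₀ , z₀∈M , _ = longer⇒∃∉ {T = []} u (ℕ.≤-<-trans ℕ.z≤n d<M)
          f₀ , o₀ , g₀ = good z₀∈M
          f , o , all-good = grow (length M) M (z₀ ∷ []) ℕ.≤-refl inj₂ id (λ { (here ≡.refl) → z₀∈M })
                                  (z₀ , here ≡.refl) (f₀ , o₀ , g₀ ∷ [])
      in f , o , gp all-good
      where
      gp : ∀ {f} → (∀ {z} → z ∈ M → Good z f) → GeneralPosition f M
      gp all-good T (len , uT , T⊆M) =
        -- A list of at most `d` vertices misses some `z`, and goodness at this `z` makes its
        -- vectors independent.
        let z , z∈M , z∉T = longer⇒∃∉ u (ℕ.≤-<-trans len d<M)
        in all-good z∈M T (len , uT ,
              All.tabulate λ x∈T → ∈-∖⁺ (All.lookup T⊆M x∈T) λ { ≡.refl → z∉T x∈T })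

  -- Base case of the induction: at most `d` vertices.

  Orthonormal : (V → Vector) → List V → Set
  Orthonormal f M = ∀ {a b} → a ∈ M → b ∈ M → (a ≡ b → dot (f a) (f b) ≈ 1#) × (a ≢ b → dot (f a) (f b) ≈ 0#)

  -- Projection scales a vector orthogonal to the list by `δ`, so each new factor is the square of a
  -- nonzero `δ` times a squared length 1.
  orthonormal⇒generalPosition : ∀ {f M} → Orthonormal f M → GeneralPosition f M
  orthonormal⇒generalPosition on []      _ = nontrivial
  orthonormal⇒generalPosition {f} on (v ∷ T) (len , v∉T ∷ uT , v∈M ∷ T⊆M) =
    *-nonzero (≉-resp (sym (dot-•• q≋ q≋)) (*-nonzero (*-nonzero δ≉0 δ≉0)
      (≉-resp (sym (proj₁ (on v∈M v∈M) ≡.refl)) nontrivial))) δ≉0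
    where
    δ≉0 : δ (map f T) ≉ 0#
    δ≉0 = orthonormal⇒generalPosition on T (ℕ.≤-trans (ℕ.n≤1+n _) len , uT , T⊆M)
    q≋ : proj (map f T) (f v) ≋ δ (map f T) • f v
    q≋ = proj-fix (map f T) (All.map⁺ (All.zipWith (λ { (v≢t , t∈M) → proj₂ (on v∈M t∈M) v≢t }) (v∉T , T⊆M)))

  orthonormal : ∀ M → length M ℕ.≤ d → ∃[ f ] Orthonormal f M
  -- Vertices of `M` go to unit vectors by position; the others get the default zero vector.
  orthonormal M len = (λ v → vector (v ∈? M)) , λ {a} {b} a∈M b∈M →
      (λ { ≡.refl → same (a ∈? M) a∈M }) , different (a ∈? M) (b ∈? M)
    where
    position : ∀ {v} → v ∈ M → Fin d
    position v∈M = Fin.inject≤ (Any.index v∈M) len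
    vector : ∀ {v} → Dec (v ∈ M) → Vector
    vector (yes v∈M) = unit (position v∈M)
    vector (no _)    = λ _ → 0#
    position-injective : ∀ {a b} (a∈M : a ∈ M) (b∈M : b ∈ M) → position a∈M ≡ position b∈M → a ≡ b
    position-injective a∈M b∈M eq = ≡.trans (Any.lookup-index a∈M) (≡.trans
      (≡.cong (lookup M) (Fin.inject≤-injective len len _ _ eq)) (≡.sym (Any.lookup-index b∈M)))
    same : ∀ {a} (a? : Dec (a ∈ M)) → a ∈ M → dot (vector a?) (vector a?) ≈ 1#
    same (no a∉M)  a∈M = contradiction a∈M a∉M
    same (yes a∈M) _   = trans (Σ-unit (position a∈M) _) (unit-≡ (position a∈M))
    different : ∀ {a b} (a? : Dec (a ∈ M)) (b? : Dec (b ∈ M)) → a ≢ b → dot (vector a?) (vector b?) ≈ 0#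
    different (no _)  _       _ = Σ-zero d λ _ → zeroˡ _
    different (yes _) (no _)  _ = Σ-zero d λ _ → zeroʳ _
    different (yes a∈M) (yes b∈M) a≢b = trans (Σ-unit (position a∈M) _)
      (unit-≢ λ eq → a≢b (≡.sym (position-injective b∈M a∈M eq)))

  representation : ∀ m M → Unique M → length M ℕ.≤ m → Representation M
  representation m M u len with length M ℕ.≤? d
  ... | yes M≤d = let f , on = orthonormal M M≤d in
        f , (λ a∈M b∈M a≢b _ → proj₂ (on a∈M b∈M) a≢b) , orthonormal⇒generalPosition on
  ... | no M≰d with m
  ...   | zero  = contradiction (ℕ.≤-trans len ℕ.z≤n) M≰d
  ...   | suc m = Step.representation M u (ℕ.≰⇒> M≰d) λ z∈M →
                    representation m _ (∖-unique u) (ℕ.s≤s⁻¹ (ℕ.<-≤-trans (length-∖ z∈M) len))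

  -- Nonzero products along edges.

  vertices : List V
  vertices = allFin n

  vertices-unique : Unique vertices
  vertices-unique = Unique.allFin⁺ n

  Faithful : (V → Vector) → List (V × V) → Set
  Faithful f = All λ (a , b) → Edge G a b → dot (f a) (f b) ≉ 0#

  -- The vector of `b` becomes the projection `y` of `f a` off the nonneighbours of `b`. These and
  -- `a` are at most `d` vertices, so `dot y y` is nonzero, and by `proj-adjoint` it is a multiple
  -- of the product of `y` with `f a`.
  separate : ∀ {f a b} → Orthogonal f vertices → GeneralPosition f vertices → Edge G a b →
             ∃[ g ] (Orthogonal g vertices × GeneralPosition g (vertices ∖ b) × dot (g a) (g b) ≉ 0#)
  separate {f} {a} {b} of gf ab = f [ b ≔ y ] , update-orthogonal of y⊥ (λ v∈ _ → v∈) ,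
      generalPosition-update (generalPosition-⊆ (λ _ → ∈-allFin _) gf) (z∉M∖z {M = vertices}) ,
      ≉-resp (sym (dot-cong (≡⇒≋ (update-≢ f y a≢b)) (≡⇒≋ (update-≡ f b y)))) ay≉0
    where
    N = nonneighbours b (vertices ∖ b)
    y = proj (map f N) (f a)
    a≢b : a ≢ b
    a≢b ≡.refl = ≡.subst T (irrefl G a) ab
    a∉N : a ∉ N
    a∉N a∈N = proj₂ (∈-nonneighbours⁻ (vertices ∖ b) a∈N) (adjacent-sym ab)
    y⊥N : All (λ w → dot y w ≈ 0#) (map f N)
    y⊥N = proj-⊥ (map f N) (f a)
    y⊥ : ∀ {v} → v ∈ vertices → v ≢ b → ¬ Edge G b v → dot y (f v) ≈ 0#
    y⊥ v∈ v≢b ¬bv = All.lookup (All.map⁻ y⊥N) (∈-filter⁺ _ (∈-∖⁺ v∈ v≢b) ¬bv)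
    δ≉0 : δ (map f (a ∷ N)) ≉ 0#
    δ≉0 = gf (a ∷ N) (nonneighbours-bound (∖-unique vertices-unique) (z∉M∖z {M = vertices}) ,
            ∉⇒All≢ a∉N ∷ Unique.filter⁺ _ (∖-unique vertices-unique) , All.tabulate λ _ → ∈-allFin _)
    ay≉0 : dot (f a) y ≉ 0#
    ay≉0 = ≉-resp (dot-comm y (f a)) (*-nonzeroʳ (≉-resp (proj-adjoint (map f N) (f a) y⊥N) (*-nonzeroˡ δ≉0)))

  -- Edges are treated one at a time: with `b` chosen last, a curve carries general position and the
  -- earlier nonzero products over from `f` and the new nonzero product from `g`.
  faithful-on : ∀ E → ∃[ f ] (Orthogonal f vertices × GeneralPosition f vertices × Faithful f E)
  faithful-on [] = let f , of , gf = representation n vertices vertices-unique (ℕ.≤-reflexive (length-tabulate id))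
                   in f , of , gf , []
  faithful-on ((a , b) ∷ E) = insert (T? (adj G a b)) (faithful-on E)
    where
    insert : Dec (Edge G a b) → ∃[ f ] (Orthogonal f vertices × GeneralPosition f vertices × Faithful f E) →
             ∃[ f ] (Orthogonal f vertices × GeneralPosition f vertices × Faithful f ((a , b) ∷ E))
    insert (no ¬ab) (f , of , gf , ff) = f , of , gf , (λ ab → contradiction ab ¬ab) ∷ ff
    insert (yes ab) (f , of , gf , ff) =
      let g , og , gg , ab≉0 = separate of gf ab
          h , oh , (gh , fh) , ab≉0' = combine (b ∷ vertices ∖ b) (∷∖-unique vertices-unique)
            (orthogonal-⊆ (λ _ → ∈-allFin _) of)
            (generalPosition⇒nondegenerate gf _ (∷∖-unique vertices-unique) λ _ → ∈-allFin _)
            (orthogonal-⊆ (λ _ → ∈-allFin _) og) (deleted⇒nondegenerate vertices-unique gg)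
            (open-× (open-GeneralPosition vertices) (open-All (λ (a , b) → open-→ (T? (adj G a b)) (open-dot a b)) E))
            (open-dot a b) (gf , ff) ab≉0
      in h , orthogonal-⊆ ∷∖-⊇ oh , gh , (λ _ → ab≉0') ∷ fh

  faithful : ∃[ f ] ((∀ {a b} → a ≢ b → ¬ Edge G a b → dot (f a) (f b) ≈ 0#) ×
                     (∀ {a b} → Edge G a b → dot (f a) (f b) ≉ 0#))
  faithful = let f , of , _ , ff = faithful-on (cartesianProduct vertices vertices) in
    f , (λ a≢b → of (∈-allFin _) (∈-allFin _) a≢b) ,
    λ {a} {b} → All.lookup ff (∈-cartesianProduct⁺ (∈-allFin a) (∈-allFin b))

-- Nullity and zero forcing

module Nullity (ℝ : CompleteOrderedField) where
  open Sums ℝ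
  open Solver using (solve; _:=_; _:+_; _:*_)

  module _ {n : ℕ} where

    Independent : ∀ {r} → (Fin r → Fin n → Carrier) → Set
    Independent {r} v = ∀ (c : Fin r → Carrier) → (∀ j → Σ[ r ] (λ l → c l * v l j) ≈ 0#) → ∀ l → c l ≈ 0#

    Closed : ((Fin n → Carrier) → Set) → Set
    Closed U = ∀ α β {x y} → U x → U y → U (λ j → α * x j + β * y j)

    ⟨_,_⟩ : (a x : Fin n → Carrier) → Carrier
    ⟨ a , x ⟩ = Σ[ n ] (λ j → a j * x j)

    pairing-lin : ∀ a α β x y → ⟨ a , (λ j → α * x j + β * y j) ⟩ ≈ α * ⟨ a , x ⟩ + β * ⟨ a , y ⟩
    pairing-lin a α β x y = begin
      Σ[ n ] (λ j → a j * (α * x j + β * y j))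
        ≈⟨ Σ-cong n (λ j → solve 5 (λ a α x β y → a :* (α :* x :+ β :* y) := α :* (a :* x) :+ β :* (a :* y)) refl (a j) α (x j) β (y j)) ⟩
      Σ[ n ] (λ j → α * (a j * x j) + β * (a j * y j))  ≈⟨ Σ-+ n _ _ ⟩
      Σ[ n ] (λ j → α * (a j * x j)) + Σ[ n ] (λ j → β * (a j * y j))  ≈⟨ +-cong (Σ-* n α _) (Σ-* n β _) ⟩
      α * ⟨ a , x ⟩ + β * ⟨ a , y ⟩  ∎

    closed-⊥ : ∀ a → Closed (λ x → ⟨ a , x ⟩ ≈ 0#)
    closed-⊥ a α β {x} {y} ax ay = trans (pairing-lin a α β x y)
      (trans (+-cong (trans (*-congˡ ax) (zeroʳ α)) (trans (*-congˡ ay) (zeroʳ β))) (+-identityˡ 0#))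

    closed-× : ∀ {U W} → Closed U → Closed W → Closed (λ x → U x × W x)
    closed-× cU cW α β (ux , wx) (uy , wy) = cU α β ux uy , cW α β wx wy

    Σ-remove : ∀ {r} (f : Fin (suc r) → Carrier) p → Σ[ suc r ] f ≈ f p + Σ[ r ] (f ∘ punchIn p)
    Σ-remove f zero = refl
    Σ-remove {suc r} f (suc p) = trans (+-congˡ (Σ-remove (f ∘ suc) p))
      (solve 3 (λ a b c → a :+ (b :+ c) := b :+ (a :+ c)) refl (f zero) (f (suc p)) _)

    -- A linear condition costs one vector: one with nonzero pairing serves as pivot and clears the
    -- pairings of the others; if there is none, the first vector is dropped.
    eliminate : ∀ {U r} → Closed U → ∀ a (v : Fin (suc r) → Fin n → Carrier) → Independent v → (∀ l → U (v l)) →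
                ∃[ w ] (Independent {r} w × (∀ l → U (w l) × ⟨ a , w l ⟩ ≈ 0#))
    eliminate {U} {r} closed a v ind uv with Fin.any? (λ l → ¬? (≈0? ⟨ a , v l ⟩))
    ... | no none = v ∘ suc , ind' , λ l → uv (suc l) , vanish (suc l)
      where
      vanish : ∀ l → ⟨ a , v l ⟩ ≈ 0#
      vanish l with ≈0? ⟨ a , v l ⟩
      ... | yes p = p
      ... | no ¬p = contradiction (l , ¬p) none
      ind' : Independent (v ∘ suc)
      ind' c Σ≈0 l = ind (0# Vector.∷ c) (λ j → trans (+-cong (zeroˡ _) (Σ≈0 j)) (+-identityˡ 0#)) (suc l)
    ... | yes (p , φp≉0) = w , ind' , λ l → closed (φ p) (- φ (punchIn p l)) (uv (punchIn p l)) (uv p) , w⊥ l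
      where
      φ : Fin (suc r) → Carrier
      φ l = ⟨ a , v l ⟩
      w : Fin r → Fin n → Carrier
      w l j = φ p * v (punchIn p l) j + - φ (punchIn p l) * v p j
      w⊥ : ∀ l → ⟨ a , w l ⟩ ≈ 0#
      w⊥ l = begin
        ⟨ a , w l ⟩                                       ≈⟨ pairing-lin a _ _ _ _ ⟩
        φ p * φ (punchIn p l) + - φ (punchIn p l) * φ p   ≈⟨ +-cong (*-comm _ _) (sym (-‿distribˡ-* _ _)) ⟩
        φ (punchIn p l) * φ p + - (φ (punchIn p l) * φ p) ≈⟨ -‿inverseʳ _ ⟩
        0#                                                ∎
      ind' : Independent w
      ind' c Σ≈0 l = *-cancel-0 φp≉0 (trans (*-comm _ _) (trans
          (reflexive (≡.sym (Vector.insertAt-punchIn (λ l → c l * φ p) p s l)))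
          (ind c' (λ j → trans (Σc' j) (Σ≈0 j)) (punchIn p l))))
        where
        s : Carrier
        s = Σ[ r ] (λ l → c l * - φ (punchIn p l))
        c' : Fin (suc r) → Carrier
        -- A relation among the `w` rewritten in the `v`: the other coefficients are multiplied by
        -- `φ p`, and the pivot collects `s`.
        c' = Vector.insertAt (λ l → c l * φ p) p s
        Σc' : ∀ j → Σ[ suc r ] (λ l → c' l * v l j) ≈ Σ[ r ] (λ l → c l * w l j)
        Σc' j = begin
          Σ[ suc r ] (λ l → c' l * v l j)
            ≈⟨ Σ-remove (λ l → c' l * v l j) p ⟩
          c' p * v p j + Σ[ r ] (λ l → c' (punchIn p l) * v (punchIn p l) j)
            ≈⟨ +-cong (*-congʳ (reflexive (Vector.insertAt-lookup (λ l → c l * φ p) p s)))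
                      (Σ-cong r λ l → *-congʳ (reflexive (Vector.insertAt-punchIn (λ l → c l * φ p) p s l))) ⟩
          s * v p j + Σ[ r ] (λ l → c l * φ p * v (punchIn p l) j)
            ≈⟨ +-congʳ (trans (*-comm _ _) (sym (Σ-* r (v p j) _))) ⟩
          Σ[ r ] (λ l → v p j * (c l * - φ (punchIn p l))) + Σ[ r ] (λ l → c l * φ p * v (punchIn p l) j)
            ≈⟨ Σ-+ r _ _ ⟨
          Σ[ r ] (λ l → v p j * (c l * - φ (punchIn p l)) + c l * φ p * v (punchIn p l) j)
            ≈⟨ Σ-cong r (λ l → solve 5 (λ c m vp φp vl → vp :* (c :* m) :+ c :* φp :* vl := c :* (φp :* vl :+ m :* vp)) refl (c l) _ _ _ _) ⟩
          Σ[ r ] (λ l → c l * w l j)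
            ∎

    annihilate : ∀ {U} → Closed U → ∀ as {r s} → s ≡ length as ℕ.+ r →
                 ∀ (v : Fin s → Fin n → Carrier) → Independent v → (∀ l → U (v l)) →
                 ∃[ w ] (Independent {r} w × (∀ l → U (w l) × All (λ a → ⟨ a , w l ⟩ ≈ 0#) as))
    annihilate closed []       ≡.refl v ind uv = v , ind , λ l → uv l , []
    annihilate closed (a ∷ as) ≡.refl v ind uv =
      let w , ind-w , uw = eliminate closed a v ind uv
          z , ind-z , uz = annihilate (closed-× closed (closed-⊥ a)) as ≡.refl w ind-w uw
      in z , ind-z , λ l → let (u , a⊥) , as⊥ = uz l in u , a⊥ ∷ as⊥

    unit-independent : Independent unit
    unit-independent c Σ≈0 l = trans (sym (trans
      (Σ-single n _ l λ j j≢l → trans (*-congˡ (unit-≢ j≢l)) (zeroʳ _))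
      (trans (*-congˡ (unit-≡ l)) (*-identityʳ _)))) (Σ≈0 l)

  module _ {n : ℕ} (G : Graph n) {A : Matrix n} (A∈S : InS G A) where

    -- Row `v` of the kernel equation keeps a single term: at blue vertices, `v` among them, `x`
    -- vanishes, and at other white vertices the entry of `A` does. So `A v w * x w` is zero while
    -- `A v w` is not.
    force-vanishing : ∀ (x : Fin n → Carrier) → (∀ i → Σ[ n ] (λ j → A i j * x j) ≈ 0#) → ∀ {B B'} → Force G B B' →
                      (∀ i → i Subset.∈ B → x i ≈ 0#) → ∀ i → i Subset.∈ B' → x i ≈ 0#
    force-vanishing x Ax≈0 {B} (force v w v∈B w∉B vw only) x≈0 i i∈ with Subset.x∈p∪q⁻ B _ i∈
    ... | inj₁ i∈B = x≈0 i i∈B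
    ... | inj₂ i∈w with Subset.x∈⁅y⁆⇒x≡y w i∈w
    ...   | ≡.refl = *-cancel-0 Avw≉0 (trans (sym (Σ-single n _ w others)) (Ax≈0 v))
      where
      v≢w : v ≢ w
      v≢w ≡.refl = w∉B v∈B
      Avw≉0 : A v w ≉ 0#
      Avw≉0 = Equivalence.to (proj₂ A∈S v w v≢w) vw
      others : ∀ j → j ≢ w → A v j * x j ≈ 0#
      others j j≢w with j Subset.∈? B
      ... | yes j∈B = trans (*-congˡ (x≈0 j j∈B)) (zeroʳ _)
      ... | no  j∉B = trans (*-congʳ (¬¬0⇒0 λ Avj≉0 → j≢w (only j
                        (Equivalence.from (proj₂ A∈S v j λ { ≡.refl → j∉B v∈B }) Avj≉0) j∉B))) (zeroˡ _)

    forces-vanishing : ∀ (x : Fin n → Carrier) → (∀ i → Σ[ n ] (λ j → A i j * x j) ≈ 0#) → ∀ {B B'} → Forces G B B' →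
                       (∀ i → i Subset.∈ B → x i ≈ 0#) → ∀ i → i Subset.∈ B' → x i ≈ 0#
    forces-vanishing x Ax≈0 done        x≈0 = x≈0
    forces-vanishing x Ax≈0 (more f fs) x≈0 = forces-vanishing x Ax≈0 fs (force-vanishing x Ax≈0 f x≈0)

    elements : ∀ {m} → Subset m → List (Fin m)
    elements []                    = []
    elements (Subset.inside  ∷ p) = zero ∷ map suc (elements p)
    elements (Subset.outside ∷ p) = map suc (elements p)

    length-elements : ∀ {m} (p : Subset m) → length (elements p) ≡ ∣ p ∣
    length-elements []                    = ≡.refl
    length-elements (Subset.inside  ∷ p) = ≡.cong suc (≡.trans (length-map suc (elements p)) (length-elements p))
    length-elements (Subset.outside ∷ p) = ≡.trans (length-map suc (elements p)) (length-elements p)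

    ∈-elements : ∀ {m} {p : Subset m} {i} → i Subset.∈ p → i ∈ elements p
    ∈-elements {p = Subset.inside  ∷ p} Vec.here        = here ≡.refl
    ∈-elements {p = Subset.inside  ∷ p} (Vec.there i∈p) = there (∈-map⁺ suc (∈-elements i∈p))
    ∈-elements {p = Subset.outside ∷ p} (Vec.there i∈p) = ∈-map⁺ suc (∈-elements i∈p)

    vanishing⇒0 : ∀ {B} (x : Fin n → Carrier) → (∀ i → Σ[ n ] (λ j → A i j * x j) ≈ 0#) → ZeroForcingSet G B →
                  All (λ a → ⟨ a , x ⟩ ≈ 0#) (map unit (elements B)) → ∀ i → x i ≈ 0#
    vanishing⇒0 {B} x Ax≈0 zfs x⊥ i = forces-vanishing x Ax≈0 zfs
      (λ i i∈B → trans (sym (Σ-unit i x)) (All.lookup (All.map⁻ x⊥) (∈-elements i∈B))) i Subset.∈⊤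

    -- Were the nullity larger than the blue set, making the blue coordinates vanish would still
    -- leave a nonempty independent family in the kernel, which forcing makes zero.
    nullity≤forcing : ∀ {r B} → NullityAtLeast A r → ZeroForcingSet G B → r ℕ.≤ ∣ B ∣
    nullity≤forcing {r} {B} (v , Av≈0 , ind) zfs with r ℕ.≤? ∣ B ∣
    ... | yes r≤B = r≤B
    ... | no  r≰B = contradiction (trans (sym (unit-≡ {suc (r ℕ.∸ suc ∣ B ∣)} zero)) (ind-w (unit zero) combination≈0 zero)) nontrivial
      where
      as = map unit (elements B)
      size : length as ≡ ∣ B ∣
      size = ≡.trans (length-map unit (elements B)) (length-elements B)
      -- The difference of `r` and `∣ B ∣` is written as a successor so that the remaining family
      -- visibly has an index `zero`.
      r≡ : r ≡ length as ℕ.+ suc (r ℕ.∸ suc ∣ B ∣)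
      r≡ = ≡.sym (≡.trans (≡.cong (ℕ._+ _) size) (≡.trans (ℕ.+-suc ∣ B ∣ _) (ℕ.m+[n∸m]≡n (ℕ.≰⇒> r≰B))))
      reduced = annihilate {U = λ x → ∀ i → Σ[ n ] (λ j → A i j * x j) ≈ 0#}
        (λ α β ux uy i → closed-⊥ (A i) α β (ux i) (uy i)) as r≡ v ind Av≈0
      w = proj₁ reduced
      ind-w = proj₁ (proj₂ reduced)
      w≈0 : ∀ j → w zero j ≈ 0#
      w≈0 = let Aw≈0 , w⊥ = proj₂ (proj₂ reduced) zero in vanishing⇒0 {B} (w zero) Aw≈0 zfs w⊥
      combination≈0 : ∀ j → Σ[ suc (r ℕ.∸ suc ∣ B ∣) ] (λ l → unit zero l * w l j) ≈ 0#
      combination≈0 j = trans (Σ-unit zero (λ l → w l j)) (w≈0 j)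

  -- The matrix factors through `d` coordinate functionals, and `d` conditions on the n unit vectors
  -- leave k independent combinations that all of them kill.
  gram-nullity : ∀ {n d k} → n ≡ d ℕ.+ k → (f : Fin n → Fin d → Carrier) →
                 NullityAtLeast (λ i j → Σ[ d ] (λ c → f i c * f j c)) k
  gram-nullity {n} {d} {k} n≡d+k f =
    let w , ind , w⊥ = annihilate {U = λ _ → ⊤} (λ _ _ _ _ → tt) rows n≡ unit unit-independent (λ _ → tt)
    in w , (λ l i → kills (w l) (λ c → All.lookup (proj₂ (w⊥ l)) (∈-tabulate⁺ c)) i) , ind
    where
    rows = tabulate (λ c j → f j c)
    n≡ : n ≡ length rows ℕ.+ k
    n≡ = ≡.trans n≡d+k (≡.cong (ℕ._+ k) (≡.sym (length-tabulate _)))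
    kills : ∀ x → (∀ c → ⟨ (λ j → f j c) , x ⟩ ≈ 0#) →
            ∀ i → Σ[ n ] (λ j → Σ[ d ] (λ c → f i c * f j c) * x j) ≈ 0#
    kills x x⊥ i = begin
      Σ[ n ] (λ j → Σ[ d ] (λ c → f i c * f j c) * x j)
        ≈⟨ Σ-cong n (λ j → trans (*-comm _ _) (sym (Σ-* d (x j) _))) ⟩
      Σ[ n ] (λ j → Σ[ d ] (λ c → x j * (f i c * f j c)))
        ≈⟨ Σ-swap n d _ ⟩
      Σ[ d ] (λ c → Σ[ n ] (λ j → x j * (f i c * f j c)))
        ≈⟨ Σ-cong d (λ c → trans (Σ-cong n λ j → solve 3 (λ x a b → x :* (a :* b) := a :* (b :* x)) refl (x j) (f i c) (f j c)) (Σ-* n (f i c) _)) ⟩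
      Σ[ d ] (λ c → f i c * ⟨ (λ j → f j c) , x ⟩)
        ≈⟨ Σ-zero d (λ c → trans (*-congˡ (x⊥ c)) (zeroʳ _)) ⟩
      0#
        ∎

-- Vertex cuts

comprehension : ∀ {n} {P : Fin n → Set} → Decidable P → Subset n
comprehension P? = Vec.tabulate (λ i → does (P? i))

module _ {n : ℕ} {P : Fin n → Set} (P? : Decidable P) where

  ∈-comprehension⁺ : ∀ {i} → P i → i Subset.∈ comprehension P?
  ∈-comprehension⁺ {i} p = Vec.lookup⇒[]= i _ (≡.trans (Vec.lookup∘tabulate _ i) (dec-true (P? i) p))

  ∈-comprehension⁻ : ∀ {i} → i Subset.∈ comprehension P? → P i
  ∈-comprehension⁻ {i} i∈ with P? i | ≡.trans (≡.sym (Vec.lookup∘tabulate (λ i → does (P? i)) i)) (Vec.[]=⇒lookup i∈)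
  ... | yes p | _ = p

-- An injection is given as a relation because the image of `i` is available only from the proof
-- that `i` lies in `P`.
card-≤ : ∀ {n m} (P : Subset n) (Q : Subset m) (R : Fin n → Fin m → Set) →
         (∀ {i} → i Subset.∈ P → ∃[ q ] (q Subset.∈ Q × R i q)) →
         (∀ {i j q} → R i q → R j q → i ≡ j) → ∣ P ∣ ℕ.≤ ∣ Q ∣
card-≤ []                   Q R f inj = ℕ.z≤n
card-≤ (Subset.outside ∷ P) Q R f inj =
  card-≤ P Q (R ∘ suc) (f ∘ Vec.there) λ r s → Fin.suc-injective (inj r s)
card-≤ (Subset.inside ∷ P) Q R f inj with f Vec.here
... | q₀ , q₀∈Q , r₀ = ℕ.≤-<-trans
  (card-≤ P (Q - q₀) (R ∘ suc)
    (λ i∈P → let q , q∈Q , r = f (Vec.there i∈P)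
             in q , Subset.x∈p∧x≢y⇒x∈p-y q∈Q (λ { ≡.refl → contradiction (inj r r₀) λ () }) , r)
    λ r s → Fin.suc-injective (inj r s))
  (Subset.x∈p⇒∣p-x∣<∣p∣ q₀∈Q)

module _ {n : ℕ} where
  open DecMembership (_≟_ {n}) using (_∈?_)

  without : List (Fin n) → Subset n
  without M = comprehension (λ x → ¬? (x ∈? M))

  ∈⇒∉-without : ∀ {x} M → x ∈ M → x Subset.∉ without M
  ∈⇒∉-without M x∈M x∈ = ∈-comprehension⁻ (λ x → ¬? (x ∈? M)) x∈ x∈M

  ∉-without⇒∈ : ∀ {x M} → x Subset.∉ without M → x ∈ M
  ∉-without⇒∈ {x} {M} x∉ = decidable-stable (x ∈? M) (x∉ ∘ ∈-comprehension⁺ (λ x → ¬? (x ∈? M)))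

  ∣without∣ : ∀ M → Unique M → ∣ without M ∣ ℕ.+ length M ℕ.≤ n
  ∣without∣ []      _         = ℕ.≤-trans (ℕ.≤-reflexive (ℕ.+-identityʳ _)) (Subset.∣p∣≤n (without []))
  ∣without∣ (x ∷ M) (x∉M ∷ u) = ℕ.≤-trans (ℕ.≤-reflexive (ℕ.+-suc _ (length M))) (ℕ.≤-trans
    (ℕ.+-monoˡ-≤ (length M) (Subset.p⊂q⇒∣p∣<∣q∣ (smaller , x , x∈ , ∈⇒∉-without (x ∷ M) (here ≡.refl))))
    (∣without∣ M u))
    where
    x∈ : x Subset.∈ without M
    x∈ = ∈-comprehension⁺ (λ x → ¬? (x ∈? M)) λ x∈M → All.lookup x∉M x∈M ≡.refl
    smaller : without (x ∷ M) Subset.⊆ without M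
    smaller y∈ = ∈-comprehension⁺ (λ x → ¬? (x ∈? M)) (∈-comprehension⁻ (λ y → ¬? (y ∈? x ∷ M)) y∈ ∘ there)

module Cuts {n k : ℕ} (G : Graph n) (κ : KConnected k G) where
  open DecMembership (_≟_ {n}) using (_∈?_)

  reach-closed : ∀ {S} {A : Fin n → Set} → (∀ {i j} → A i → j Subset.∉ S → Edge G i j → A j) →
                 ∀ {a b} → A a → Reach G S a b → A b
  reach-closed closed Aa (here _)      = Aa
  reach-closed closed Aa (step r l∉ e) = closed (reach-closed closed Aa r) l∉ e

  -- The form in which k-connectivity is applied: `A` separates `a` from `b` once `S` is removed.
  -- The graph is not complete, since an edge from `a` to `b` would carry `A` over to `b`.
  cut : ∀ S (A : Fin n → Set) {a b} → a Subset.∉ S → A a → b Subset.∉ S → ¬ A b →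
        (∀ {i j} → A i → j Subset.∉ S → Edge G i j → A j) → k ℕ.≤ ∣ S ∣
  cut S A {a} {b} a∉S Aa b∉S ¬Ab closed = proj₂ (proj₂ κ incomplete) S
      λ conn → ¬Ab (reach-closed closed Aa (conn a b a∉S b∉S))
    where
    incomplete : ¬ IsComplete G
    incomplete complete = ¬Ab (closed Aa b∉S (complete a b λ { ≡.refl → ¬Ab Aa }))

  -- Removing all vertices but `c` and the listed nonneighbours isolates `c`, with `t` on the other
  -- side.
  nonneighbours-bound : ∀ c t T → Unique (t ∷ T) → (∀ {b} → b ∈ t ∷ T → b ≢ c × ¬ Edge G c b) →
                        k ℕ.+ suc (length (t ∷ T)) ℕ.≤ n
  nonneighbours-bound c t T u non = ℕ.≤-trans (ℕ.+-monoˡ-≤ _ k≤S)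
      (∣without∣ M (All.tabulate (λ b∈ → proj₁ (non b∈) ∘ ≡.sym) ∷ u))
    where
    M = c ∷ t ∷ T
    closed : ∀ {i j} → i ≡ c → j Subset.∉ without M → Edge G i j → j ≡ c
    closed ≡.refl j∉ ij with ∉-without⇒∈ {M = M} j∉
    ... | here j≡c = j≡c
    ... | there j∈ = contradiction ij (proj₂ (non j∈))
    k≤S : k ℕ.≤ ∣ without M ∣
    k≤S = cut (without M) (_≡ c) {c} {t} (∈⇒∉-without M (here ≡.refl)) ≡.refl
              (∈⇒∉-without M (there (here ≡.refl))) (proj₁ (non (here ≡.refl))) closed

  k<n : Fin n → k ℕ.< n
  k<n c with Fin.any? (λ i → Fin.any? (λ j → ¬? (j ≟ i) ×-dec ¬? (T? (adj G i j))))
  ... | yes (i , j , non) = ℕ.≤-trans (ℕ.≤-trans (ℕ.n≤1+n _) (ℕ.≤-reflexive (ℕ.+-comm 2 k)))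
                              (nonneighbours-bound i j [] (All.[] ∷ []) λ { (here ≡.refl) → non })
  ... | no none = ℕ.≤-<-trans (proj₁ κ complete) (pred< c)
    where
    complete : IsComplete G
    complete i j i≢j = decidable-stable (T? (adj G i j)) λ ¬ij → none (i , j , i≢j ∘ ≡.sym , ¬ij)
    pred< : ∀ {m} → Fin m → m ℕ.∸ 1 ℕ.< m
    pred< {suc m} _ = ℕ.n<1+n m

  few-nonneighbours : ∀ c T → Unique T → (∀ {b} → b ∈ T → b ≢ c × ¬ Edge G c b) → length T ℕ.< n ℕ.∸ k
  few-nonneighbours c []      u non = ℕ.m<n⇒0<n∸m (k<n c)
  few-nonneighbours c (t ∷ T) u non = ℕ.≤-trans (ℕ.≤-reflexive (≡.sym (ℕ.m+n∸m≡n k _)))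
                                                (ℕ.∸-monoˡ-≤ k (nonneighbours-bound c t T u non))

  -- Fewer than k vertices lie outside `M`, too few to separate `Z` from the rest of `M`.
  large-connected : ∀ M → Unique M → n ℕ.∸ k ℕ.< length M → ∀ Z → (∀ {z} → z ∈ Z → z ∈ M) → ∀ {z} → z ∈ Z →
                    (∀ {i j} → i ∈ Z → j ∈ M → Edge G i j → j ∈ Z) → ∀ {w} → w ∈ M → w ∈ Z
  large-connected M u large Z Z⊆M z∈Z closed {w} w∈M = decidable-stable (w ∈? Z) λ w∉Z →
    let k≤S = cut (without M) (_∈ Z) (∈⇒∉-without M (Z⊆M z∈Z)) z∈Z (∈⇒∉-without M w∈M) w∉Z
                  (λ i∈Z j∉ ij → closed i∈Z (∉-without⇒∈ {M = M} j∉) ij)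
    in ℕ.<⇒≱ large (ℕ.≤-trans (ℕ.≤-reflexive (≡.sym (ℕ.m+n∸m≡n k _)))
                 (ℕ.∸-monoˡ-≤ k (ℕ.≤-trans (ℕ.+-monoˡ-≤ (length M) k≤S) (∣without∣ M u))))

-- Forcing along a k-path

kpath-size : ∀ {k m} {A : Fin m → Fin m → Bool} {e} → KPath k A e → ∣ e ∣ ≡ k
kpath-size (start _ _ _ _ ∣e₁∣≡k _)           = ∣e₁∣≡k
kpath-size (extend _ _ _ _ _ _ _ ∣e'∣≡k _) = ∣e'∣≡k

-- By counting: a set without index zero would be all of `e`, so the new vertex enters, and equality
-- of sizes makes exactly one vertex `v` leave.
exchange : ∀ {m} {e : Subset m} {e' : Subset (suc m)} → e' Subset.⊆ (true ∷ e) → ∣ e' ∣ ≡ ∣ e ∣ → e' ≢ false ∷ e →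
           ∃[ f ] (e' ≡ true ∷ f × f Subset.⊆ e × ∃[ v ] (v Subset.∈ e × v Subset.∉ f ×
                   (∀ {q} → q Subset.∈ e → q Subset.∉ f → q ≡ v)))
exchange {e = e} {false ∷ f} f⊆e' size e'≢ = contradiction (≡.cong (false ∷_) f≡e) e'≢
  where
  f⊆e : f Subset.⊆ e
  f⊆e = Subset.drop-∷-⊆ f⊆e'
  f≡e : f ≡ e
  f≡e = Subset.⊆-antisym f⊆e λ {x} x∈e → decidable-stable (x Subset.∈? f) λ x∉f →
    ℕ.<⇒≢ (Subset.p⊂q⇒∣p∣<∣q∣ (f⊆e , x , x∈e , x∉f)) size
exchange {e = e} {true ∷ f} f⊆e' size e'≢ with Fin.any? (λ v → v Subset.∈? e ×-dec ¬? (v Subset.∈? f))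
... | no none = contradiction (Subset.p⊆q⇒∣p∣≤∣q∣ e⊆f) (ℕ.<⇒≱ (ℕ.≤-reflexive size))
  where
  e⊆f : e Subset.⊆ f
  e⊆f {x} x∈e = decidable-stable (x Subset.∈? f) λ x∉f → none (x , x∈e , x∉f)
... | yes (v , v∈e , v∉f) = f , ≡.refl , f⊆e , v , v∈e , v∉f , unique
  where
  f⊆e : f Subset.⊆ e
  f⊆e = Subset.drop-∷-⊆ f⊆e'
  unique : ∀ {q} → q Subset.∈ e → q Subset.∉ f → q ≡ v
  unique {q} q∈e q∉f = decidable-stable (q ≟ v) λ q≢v →
    ℕ.<-irrefl size (ℕ.≤-<-trans
      (Subset.p⊂q⇒∣p∣<∣q∣ {p = f} {e - v}
        ((λ {x} x∈f → Subset.x∈p∧x≢y⇒x∈p-y (f⊆e x∈f) λ { ≡.refl → v∉f x∈f }) ,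
         q , Subset.x∈p∧x≢y⇒x∈p-y q∈e q≢v , q∉f))
      (Subset.x∈p⇒∣p-x∣<∣p∣ v∈e))

module KPathForcing {n k : ℕ} (1≤k : 1 ℕ.≤ k) (G : Graph n) (κ : KConnected k G) where
  open Cuts G κ

  Placement : ℕ → Set
  Placement m = Fin n → Maybe (Fin m)

  -- A placement of G relative to an initial piece of a k-path: 'nothing'
  -- stands for the vertices of the k-path added after this piece.
  record Layout {m} (A : Fin m → Fin m → Bool) (e : Subset m) (φ : Placement m) : Set where
    field
      injective : ∀ {i j p} → φ i ≡ just p → φ j ≡ just p → i ≡ j
      edges     : ∀ {i j p q} → φ i ≡ just p → φ j ≡ just q → Edge G i j → T (A p q)
      late      : ∀ {i j q} → φ i ≡ nothing → φ j ≡ just q → Edge G i j → q Subset.∈ e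
  open Layout

  -- `Maybe.All` holds on `nothing`, so later vertices count as blue: forcing runs backwards from
  -- the last k-set and has already passed them.
  Blue : ∀ {m} → Subset m → Placement m → Fin n → Set
  Blue e φ i = Maybe.All (Subset._∈ e) (φ i)

  blue? : ∀ {m} (e : Subset m) (φ : Placement m) → Decidable (Blue e φ)
  blue? e φ i = Maybe.dec (Subset._∈? e) (φ i)

  blue : ∀ {m} → Subset m → Placement m → Subset n
  blue e φ = comprehension (blue? e φ)

  down : ∀ {m} → Maybe (Fin (suc m)) → Maybe (Fin m)
  down nothing        = nothing
  down (just zero)    = nothing
  down (just (suc p)) = just p

  down-just : ∀ {m} (x : Maybe (Fin (suc m))) {p} → down x ≡ just p → x ≡ just (suc p)
  down-just (just (suc p)) ≡.refl = ≡.refl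

  down-nothing : ∀ {m} (x : Maybe (Fin (suc m))) → down x ≡ nothing → x ≡ nothing ⊎ x ≡ just zero
  down-nothing nothing     _ = inj₁ ≡.refl
  down-nothing (just zero) _ = inj₂ ≡.refl

  adjacent-sym : ∀ {i j} → Edge G i j → Edge G j i
  adjacent-sym {i} {j} = ≡.subst T (adj-sym G i j)

  T⇒∈ : ∀ {m} {e : Subset m} {q b} → b ≡ Vec.lookup e q → T b → q Subset.∈ e
  T⇒∈ {q = q} eq t = Vec.lookup⇒[]= q _ (≡.trans (≡.sym eq) (Equivalence.to T-≡ t))

  all-blue : ∀ {m} {e : Subset m} {φ} → (∀ i → Blue e φ i) → ZeroForcingSet G (blue e φ)
  all-blue {e = e} {φ} all = ≡.subst (λ B → Forces G B Subset.⊤)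
    (Subset.⊆-antisym (λ {i} _ → ∈-comprehension⁺ (blue? e φ) (all i)) Subset.⊆⊤) done

  module Start {A : Fin (suc k) → Fin (suc k) → Bool} {e : Subset (suc k)} (∣e∣≡k : ∣ e ∣ ≡ k)
               {φ : Placement (suc k)} (L : Layout A e φ) where

    missing-unique : ∀ {p q} → p Subset.∉ e → q Subset.∉ e → p ≡ q
    missing-unique {p} {q} p∉e q∉e = decidable-stable (p ≟ q) λ p≢q →
      ℕ.<-irrefl (≡.trans (≡.cong suc ∣e∣≡k) (≡.sym (Subset.∣⊤∣≡n (suc k)))) (ℕ.≤-<-trans
        (Subset.p⊂q⇒∣p∣<∣q∣ {p = e} {Subset.⊤ - p}
          ((λ {x} x∈e → Subset.x∈p∧x≢y⇒x∈p-y Subset.∈⊤ λ { ≡.refl → p∉e x∈e }) ,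
           q , Subset.x∈p∧x≢y⇒x∈p-y Subset.∈⊤ (p≢q ∘ ≡.sym) , q∉e))
        (Subset.x∈p⇒∣p-x∣<∣p∣ {x = p} Subset.∈⊤))

    white-unique : ∀ {i j} → ¬ Blue e φ i → ¬ Blue e φ j → i ≡ j
    white-unique {i} {j} wi wj with φ i in eqi | φ j in eqj
    ... | nothing | _       = contradiction Maybe.nothing wi
    ... | just _  | nothing = contradiction Maybe.nothing wj
    ... | just p  | just q  with missing-unique (wi ∘ Maybe.just) (wj ∘ Maybe.just)
    ...   | ≡.refl = injective L eqi eqj

    -- An isolated vertex would be cut off by the empty set, against `1≤k`; other vertices exist
    -- since k < n.
    neighbour : ∀ i → ∃[ j ] Edge G j i
    neighbour i with Fin.any? (λ j → T? (adj G j i))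
    ... | yes p = p
    ... | no none = contradiction (ℕ.≤-trans 1≤k k≤0) λ ()
      where
      another : ∀ {n} → 2 ℕ.≤ n → (i : Fin n) → ∃[ j ] j ≢ i
      another {suc (suc n)} _ i = punchIn i zero , Fin.punchInᵢ≢i i zero
      another {suc zero} (ℕ.s≤s ()) _
      j = proj₁ (another (ℕ.≤-trans (ℕ.s≤s 1≤k) (k<n i)) i)
      j≢i = proj₂ (another (ℕ.≤-trans (ℕ.s≤s 1≤k) (k<n i)) i)
      k≤0 : k ℕ.≤ 0
      k≤0 = ℕ.≤-trans (cut Subset.⊥ (_≡ i) {i} {j} Subset.∉⊥ ≡.refl Subset.∉⊥ j≢i
              (λ { {j = l} ≡.refl _ il → contradiction (l , adjacent-sym il) none }))
              (ℕ.≤-reflexive (Subset.∣⊥∣≡0 n))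

    -- Only one vertex of the initial complete graph lies outside `e`, so at most one vertex of `G`
    -- is white, and any neighbour can force it.
    forcing : ZeroForcingSet G (blue e φ)
    forcing with Fin.any? (λ i → ¬? (blue? e φ i))
    ... | no none = all-blue λ i → decidable-stable (blue? e φ i) λ w → none (i , w)
    ... | yes (i , w) with neighbour i
    ...   | j , ji = more (force j i j∈B (w ∘ ∈-comprehension⁻ (blue? e φ)) ji only)
                          (≡.subst (λ B → Forces G B Subset.⊤) (≡.sym full) done)
      where
      only-white : ∀ {x} → x Subset.∉ blue e φ → x ≡ i
      only-white x∉B = white-unique (x∉B ∘ ∈-comprehension⁺ (blue? e φ)) w
      only : ∀ x → Edge G j x → x Subset.∉ blue e φ → x ≡ i
      only _ _ = only-white
      j∈B : j Subset.∈ blue e φ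
      j∈B = decidable-stable (j Subset.∈? blue e φ) λ j∉B →
        ≡.subst T (≡.trans (≡.cong (λ x → adj G x i) (only-white j∉B)) (irrefl G i)) ji
      full : blue e φ ∪ ⁅ i ⁆ ≡ Subset.⊤
      full = Subset.⊆-antisym Subset.⊆⊤ λ {x} _ → decidable-stable (x Subset.∈? _) λ x∉ →
        x∉ (Subset.x∈p∪q⁺ (inj₂ (≡.subst (Subset._∈ ⁅ i ⁆)
          (≡.sym (only-white λ x∈B → x∉ (Subset.x∈p∪q⁺ (inj₁ x∈B)))) (Subset.x∈⁅x⁆ i))))

  module Extend {m} {A : Fin m → Fin m → Bool} {e : Subset m} {A' : Fin (suc m) → Fin (suc m) → Bool}
    (f : Subset m) (∣e∣≡k : ∣ e ∣ ≡ k) (A'0 : ∀ j → A' zero (suc j) ≡ Vec.lookup e j)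
    (A's : ∀ i j → A' (suc i) (suc j) ≡ A i j) (f⊆e : f Subset.⊆ e)
    {v : Fin m} (v∈e : v Subset.∈ e) (v∉f : v Subset.∉ f) (only-v : ∀ {q} → q Subset.∈ e → q Subset.∉ f → q ≡ v)
    {φ : Placement (suc m)} (L : Layout A' (true ∷ f) φ) where

    φ' : Placement m
    φ' = down ∘ φ

    -- Index zero joins the late vertices: its neighbours in the older part lie in `e`, and those of
    -- the former late vertices lie in `f`, hence in `e`.
    layout : Layout A e φ'
    layout .injective {i} {j} p q = injective L (down-just (φ i) p) (down-just (φ j) q)
    layout .edges {i} {j} p q ij = ≡.subst T (A's _ _) (edges L (down-just (φ i) p) (down-just (φ j) q) ij)
    layout .late {i} {j} p q ij with down-nothing (φ i) p | down-just (φ j) q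
    ... | inj₁ φi | φj = f⊆e (Subset.drop-there (late L φi φj ij))
    ... | inj₂ φi | φj = T⇒∈ (A'0 _) (edges L φi φj ij)

    blue→blue' : ∀ {i} → Blue (true ∷ f) φ i → Blue e φ' i
    blue→blue' {i} b with φ i | b
    ... | nothing       | _            = Maybe.nothing
    ... | just zero     | _            = Maybe.nothing
    ... | just (suc p)  | Maybe.just p∈ = Maybe.just (f⊆e (Subset.drop-there p∈))

    blue'→ : ∀ {i} → Blue e φ' i → Blue (true ∷ f) φ i ⊎ φ i ≡ just (suc v)
    blue'→ {i} b with φ i | b
    ... | nothing      | _            = inj₁ Maybe.nothing
    ... | just zero    | _            = inj₁ (Maybe.just Vec.here)
    ... | just (suc p) | Maybe.just p∈e with p Subset.∈? f
    ...   | yes p∈f = inj₁ (Maybe.just (Vec.there p∈f))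
    ...   | no  p∉f = inj₂ (≡.cong (just ∘ suc) (only-v p∈e p∉f))

    uv-edge? : Dec (∃[ a ] ∃[ b ] (φ a ≡ just zero × φ b ≡ just (suc v) × Edge G a b))
    uv-edge? = Fin.any? λ a → Fin.any? λ b →
      ≡-dec _≟_ (φ a) (just zero) ×-dec ≡-dec _≟_ (φ b) (just (suc v)) ×-dec T? (adj G a b)

    -- The neighbours of the new vertex are late or in `e`, and `v` is the only element of `e`
    -- outside `f`.
    force-v : ∀ {a b} → φ a ≡ just zero → φ b ≡ just (suc v) → Edge G a b → Force G (blue (true ∷ f) φ) (blue e φ')
    force-v {a} {b} φa φb ab = ≡.subst (Force G B) B∪b≡B' (force a b a∈B b∉B ab only)
      where
      B = blue (true ∷ f) φ
      a∈B : a Subset.∈ B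
      a∈B = ∈-comprehension⁺ (blue? (true ∷ f) φ) (≡.subst (Maybe.All _) (≡.sym φa) (Maybe.just Vec.here))
      b∉B : b Subset.∉ B
      b∉B b∈B with ≡.subst (Maybe.All _) φb (∈-comprehension⁻ (blue? (true ∷ f) φ) b∈B)
      ... | Maybe.just v∈ = v∉f (Subset.drop-there v∈)
      only : ∀ x → Edge G a x → x Subset.∉ B → x ≡ b
      only x ax x∉B with blue'→ {x} (new x ax)
        where
        new : ∀ x → Edge G a x → Blue e φ' x
        new x ax with φ x in φx
        ... | nothing      = Maybe.nothing
        ... | just zero    = Maybe.nothing
        ... | just (suc q) = Maybe.just (T⇒∈ (A'0 q) (edges L φa φx ax))
      ... | inj₁ bx = contradiction (∈-comprehension⁺ (blue? (true ∷ f) φ) bx) x∉B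
      ... | inj₂ φx = injective L φx φb
      B∪b≡B' : B ∪ ⁅ b ⁆ ≡ blue e φ'
      B∪b≡B' = Subset.⊆-antisym to from
        where
        to : B ∪ ⁅ b ⁆ Subset.⊆ blue e φ'
        to {i} i∈ with Subset.x∈p∪q⁻ B ⁅ b ⁆ i∈
        ... | inj₁ i∈B = ∈-comprehension⁺ (blue? e φ') (blue→blue' (∈-comprehension⁻ (blue? (true ∷ f) φ) i∈B))
        ... | inj₂ i∈b with Subset.x∈⁅y⁆⇒x≡y b i∈b
        ...   | ≡.refl = ∈-comprehension⁺ (blue? e φ')
                (≡.subst (Maybe.All _ ∘ down) (≡.sym φb) (Maybe.just v∈e))
        from : blue e φ' Subset.⊆ B ∪ ⁅ b ⁆
        from {i} i∈ with blue'→ {i} (∈-comprehension⁻ (blue? e φ') i∈)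
        ... | inj₁ bi = Subset.x∈p∪q⁺ (inj₁ (∈-comprehension⁺ (blue? (true ∷ f) φ) bi))
        ... | inj₂ φi with injective L φi φb
        ...   | ≡.refl = Subset.x∈p∪q⁺ (inj₂ (Subset.x∈⁅x⁆ b))

    InSeparator : Fin n → Set
    InSeparator i = ∃[ q ] (φ i ≡ just (suc q) × q Subset.∈ f)

    inSeparator? : Decidable InSeparator
    inSeparator? i = Fin.any? λ q → ≡-dec _≟_ (φ i) (just (suc q)) ×-dec q Subset.∈? f

    -- Without an edge between u and v, the k-1 vertices of f separate the white
    -- vertices from those at u or later.
    no-white : ¬ (∃[ a ] ∃[ b ] (φ a ≡ just zero × φ b ≡ just (suc v) × Edge G a b)) →
               ∀ {i₀} → (∀ {p} → φ i₀ ≡ just p → p ≡ zero) → ∀ i → Blue (true ∷ f) φ i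
    no-white no-edge {i₀} right i = decidable-stable (blue? (true ∷ f) φ i) λ white →
        ℕ.<⇒≱ (ℕ.≤-<-trans size (≡.subst (∣ f ∣ ℕ.<_) ∣e∣≡k (Subset.p⊂q⇒∣p∣<∣q∣ (f⊆e , v , v∈e , v∉f))))
              (cut S (λ j → ¬ Blue (true ∷ f) φ j) {i} {i₀} (i∉S white) white i₀∉S (λ w → w i₀-blue) closed)
      where
      S = comprehension inSeparator?
      size : ∣ S ∣ ℕ.≤ ∣ f ∣
      size = card-≤ S f (λ i q → φ i ≡ just (suc q))
        (λ i∈S → let q , φi , q∈f = ∈-comprehension⁻ inSeparator? i∈S in q , q∈f , φi) (injective L)
      i∉S : ∀ {i} → ¬ Blue (true ∷ f) φ i → i Subset.∉ S
      i∉S white i∈S with ∈-comprehension⁻ inSeparator? i∈S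
      ... | q , φi , q∈f = white (≡.subst (Maybe.All _) (≡.sym φi) (Maybe.just (Vec.there q∈f)))
      i₀∉S : i₀ Subset.∉ S
      i₀∉S i₀∈S with ∈-comprehension⁻ inSeparator? i₀∈S
      ... | q , φi , _ with right φi
      ...   | ()
      right-blue : ∀ x → (∀ {p} → x ≡ just p → p ≡ zero) → Maybe.All (Subset._∈ (true ∷ f)) x
      right-blue nothing  _ = Maybe.nothing
      right-blue (just p) r = Maybe.just (≡.subst (Subset._∈ (true ∷ f)) (≡.sym (r ≡.refl)) Vec.here)
      i₀-blue : Blue (true ∷ f) φ i₀
      i₀-blue = right-blue (φ i₀) right
      -- A white vertex sits in the older part, outside `f`. A late neighbour would put it in `f`;
      -- adjacency to index zero would put it in `e`, hence at `v`, giving the missing edge; a blue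
      -- neighbour in the older part lies in `S`.
      closed : ∀ {i j} → ¬ Blue (true ∷ f) φ i → j Subset.∉ S → Edge G i j → ¬ Blue (true ∷ f) φ j
      closed {i} {j} white j∉S ij bj with φ i in φi
      ... | nothing      = white Maybe.nothing
      ... | just zero    = white (Maybe.just Vec.here)
      ... | just (suc p) with φ j in φj
      ...   | nothing   = white (Maybe.just (late L φj φi (adjacent-sym ij)))
      ...   | just zero = no-edge (j , i , φj ,
                ≡.trans φi (≡.cong (just ∘ suc) (only-v (T⇒∈ (A'0 p) (edges L φj φi (adjacent-sym ij)))
                                                        (λ p∈f → white (Maybe.just (Vec.there p∈f))))) , adjacent-sym ij)
      ...   | just (suc q) with bj
      ...     | Maybe.just q∈ = j∉S (∈-comprehension⁺ inSeparator? (q , φj , Subset.drop-there q∈))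

  -- Such a vertex supplies the far side of the separator in `no-white`. The condition uses `toℕ`
  -- because `Fin m` has no `zero` for an arbitrary m.
  Right : ∀ {m} → Placement m → Set
  Right φ = ∃[ i ] (∀ {p} → φ i ≡ just p → toℕ p ≡ 0)

  -- If the new vertex is joined to the dropped one, it forces it and then counts as late, which
  -- keeps `Right` for the shorter k-path. Otherwise all is blue already.
  forcing : ∀ {m A e φ} → KPath k {m} A e → Layout A e φ → Right φ → ZeroForcingSet G (blue e φ)
  forcing (start _ _ _ _ ∣e∣≡k _) L _ = Start.forcing ∣e∣≡k L
  forcing {φ = φ} (extend e' P _ A'0 _ A's e'⊆ ∣e'∣≡k e'≢) L (i₀ , right)
    with exchange e'⊆ (≡.trans ∣e'∣≡k (≡.sym (kpath-size P))) e'≢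
  ... | f , ≡.refl , f⊆e , v , v∈e , v∉f , only-v = cases uv-edge?
    where
    open Extend f (kpath-size P) A'0 A's f⊆e v∈e v∉f only-v L
    right' : ∀ {a} → φ a ≡ just zero → Right φ'
    right' {a} φa = a , λ φ'a → contradiction (≡.trans (≡.sym φ'a) (≡.cong down φa)) λ ()
    cases : Dec (∃[ a ] ∃[ b ] (φ a ≡ just zero × φ b ≡ just (suc v) × Edge G a b)) →
            ZeroForcingSet G (blue (true ∷ f) φ)
    cases (yes (a , b , φa , φb , ab)) = more (force-v φa φb ab) (forcing P layout (right' φa))
    cases (no none) = all-blue (no-white none λ φi → Fin.toℕ-injective (right φi))

  total-layout : ∀ {m} {A : Fin m → Fin m → Bool} {e} {g : Fin n → Fin m} → (∀ {i j} → g i ≡ g j → i ≡ j) →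
                 (∀ {i j} → Edge G i j → T (A (g i) (g j))) → Layout A e (just ∘ g)
  total-layout g-inj g-edge .injective p q = g-inj (just-injective (≡.trans p (≡.sym q)))
  total-layout g-inj g-edge .edges ≡.refl ≡.refl = g-edge
  total-layout g-inj g-edge .late ()

  total-size : ∀ {m A e} → KPath k {m} A e → ∀ {g : Fin n → Fin m} → (∀ {i j} → g i ≡ g j → i ≡ j) →
               ∣ blue e (just ∘ g) ∣ ℕ.≤ k
  total-size {e = e} P {g} g-inj = ≡.subst (∣ blue e (just ∘ g) ∣ ℕ.≤_) (kpath-size P)
    (card-≤ (blue e (just ∘ g)) e (λ i q → g i ≡ q)
      (λ {i} i∈ → g i , Maybe.drop-just (∈-comprehension⁻ (blue? e (just ∘ g)) i∈) , ≡.refl)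
      λ p q → g-inj (≡.trans p (≡.sym q)))

  -- Final vertices of the k-path that carry no vertex of `G` are stripped first, so that `Right`
  -- holds when forcing begins; if only the initial complete graph is left, `Start` applies.
  small-forcing-set : ∀ {m A e} → KPath k {m} A e → (g : Fin n → Fin m) → (∀ {i j} → g i ≡ g j → i ≡ j) →
                      (∀ {i j} → Edge G i j → T (A (g i) (g j))) → ∃[ B ] (ZeroForcingSet G B × ∣ B ∣ ℕ.≤ k)
  small-forcing-set {A = H} {e} P g g-inj g-edge with P
  ... | start _ _ _ _ ∣e∣≡k _ = blue e (just ∘ g) , Start.forcing ∣e∣≡k (total-layout {A = H} g-inj g-edge) , total-size P g-inj
  ... | extend {A = A} {e₀} {A'} e' P' _ _ _ A's _ _ _ with Fin.any? (λ i → g i ≟ zero)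
  ...   | yes (i₀ , gi₀) = blue e (just ∘ g) ,
          forcing P (total-layout {A = H} g-inj g-edge) (i₀ , λ { ≡.refl → ≡.cong toℕ gi₀ }) , total-size P g-inj
  ...   | no none = small-forcing-set P' g' g'-inj λ {i} {j} ij →
          ≡.subst T (≡.trans (≡.cong₂ A' (g≡ i) (g≡ j)) (A's _ _)) (g-edge ij)
    where
    g' : Fin n → Fin _
    g' i = punchOut {i = zero} (λ 0≡gi → none (i , ≡.sym 0≡gi))
    g≡ : ∀ i → g i ≡ suc (g' i)
    g≡ i = ≡.sym (Fin.punchIn-punchOut {i = zero} (λ 0≡gi → none (i , ≡.sym 0≡gi)))
    g'-inj : ∀ {i j} → g' i ≡ g' j → i ≡ j
    g'-inj eq = g-inj (≡.trans (g≡ _) (≡.trans (≡.cong suc eq) (≡.sym (g≡ _))))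

-- Combining the nullity and forcing bounds.

open import Data.Nat using (_≤_)

connectivity≤order : ∀ {n k} (G : Graph n) → KConnected k G → k ≤ n
connectivity≤order {zero}  G κ = proj₁ κ λ ()
connectivity≤order {suc n} G κ = ℕ.<⇒≤ (Cuts.k<n G κ zero)

nullity≥connectivity : (ℝ : CompleteOrderedField) → ∀ {n k} (G : Graph n) → KConnected k G →
                       ∃[ A ] (Matrices.InS ℝ G A × Matrices.NullityAtLeast ℝ A k)
nullity≥connectivity ℝ {n} {k} G κ =
    let f , orthogonal , nonorthogonal = faithful
    in (λ i j → dot (f i) (f j)) ,
       ((λ i j → dot-comm (f i) (f j)) , λ i j i≢j → mk⇔ nonorthogonal λ ≉0 →
         decidable-stable (T? (adj G i j)) λ ¬ij → ≉0 (orthogonal i≢j ¬ij)) ,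
       Nullity.gram-nullity ℝ (≡.sym (ℕ.m∸n+n≡m (connectivity≤order G κ))) f
  where
  open Cuts G κ using (few-nonneighbours; large-connected)
  open Representations ℝ G (n ℕ.∸ k) few-nonneighbours large-connected

mainTheorem5 : (ℝ : CompleteOrderedField) → (k : ℕ) → 1 ≤ k →
    ∀ {n} (G : Graph n) → KConnected k G → PartialKPath k G →
    ZeroForcingNumber G k × Matrices.MaxNullity ℝ G k
mainTheorem5 ℝ k 1≤k G κ (m , H , e , P , g , g-injective , g-edge) =
  -- The chain k ≤ nullity of `A` ≤ size of `B` ≤ k collapses to equalities.
  let A , A∈S , A-null = nullity≥connectivity ℝ G κ
      B , B-forces , ∣B∣≤k = KPathForcing.small-forcing-set 1≤k G κ P g g-injective (g-edge _ _)
  in ((B , B-forces , ℕ.≤-antisym ∣B∣≤k (Nullity.nullity≤forcing ℝ G A∈S A-null B-forces)) ,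
      λ B' B'-forces → Nullity.nullity≤forcing ℝ G A∈S A-null B'-forces) ,
     ((A , A∈S , A-null) ,
      λ A' A'∈S A'-null → ℕ.<⇒≱ (Nullity.nullity≤forcing ℝ G A'∈S A'-null B-forces) ∣B∣≤k)
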